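{- For $n\ge 1$ let $C_n$ denote the number of root isthmic parts in a uniformly random rooted map with $n$ edges (no restriction on genus). Then, as $n\to\infty$, $$C_n\ \overset{d}{\longrightarrow}\ \mathrm{Geometric}\bigl(\tfrac12\bigr),$$ where $\mathrm{Geometric}(\tfrac12)$ is the distribution on $\{1,2,3,\dots\}$ giving mass $2^{ -k}$ to each $k\ge1$.
   Context: A map is a connected multigraph (loops and multiple edges allowed) endowed with a cyclic ordering (say counterclockwise) of the half-edges incident to each vertex. Around each vertex, each pair of consecutive half-edges in the cyclic order forms a corner (a vertex with only one half-edge has one corner; a vertex of degree $d\ge1$ has $d$ corners; the one-vertex map with no edge has exactly one corner). A rooted map is a map with a distinguished corner, the root; the vertex at this corner is the root vertex. Rooted maps are considered up to isomorphisms preserving the graph structure, the root corner and the cyclic orderings. "Random rooted map with $n$ edges" means that all rooted maps with $n$ edges are equally likely. An isthmus is an edge whose deletion increases the number of connected components of the underlying graph. Recursive construction of rooted maps. Every rooted map with $n\ge1$ edges is obtained in exactly one way either (i) by connecting the root corners of two rooted maps $M_1,M_2$ (with $n-1$ edges in total) by a new edge, which is an isthmus, the root vertex of the result being that of $M_1$; or (ii) by adding to a rooted map $M_0$ with $n-1$ edges a new edge connecting the root corner to some corner of $M_0$ ($2n-1$ ways, as there are two ways of attaching the other end of the new edge at the root corner itself when $n\ge 2$). In both cases the new root corner is the one immediately preceding, in the cyclic order around the root vertex, the half-edge of the new edge inserted at the old root corner. Equivalently, for a rooted map $M$ with $n\ge1$ edges, let $e$ be the edge containing the half-edge that follows the root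 corner; delete $e$. If $e$ is an isthmus this gives $M_1$ (the component containing the root vertex) and $M_2$, each rooted at the corner left where a half-edge of $e$ was removed; otherwise it gives $M_0$, rooted at the corner left by the removal of the half-edge following the root corner. The number $c(M)$ of root isthmic parts is the number of isthmic constructions (i) used at the root vertex in this recursive construction: $c(M)=0$ if $M$ has no edge; $c(M)=1+c(M_1)$ in case (i); $c(M)=c(M_0)$ in case (ii). $\overset{d}{\longrightarrow}$ is convergence in distribution. -}

module Defs where

open import Data.Empty using (⊥; ⊥-elim)
open import Data.Fin using (Fin; zero; suc)
open import Data.Fin.Properties using (inj⇒≟; +↔⊎; 0↔⊥; 1↔⊤)
open import Data.Integer using (ℤ; +_; -[1+_])
open import Data.List using (allFin; filter; length)
open import Data.Maybe using (Maybe; just; nothing; maybe′)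
open import Data.Nat as ℕ using (ℕ; zero; suc; _≥_)
open import Data.Nat.Properties using (*-distribʳ-+; +-suc)
open import Data.Product using (∃; _×_; _,_; proj₁)
open import Data.Rational as ℚ using (ℚ; 0ℚ; ½; floor)
open import Data.Sum using (_⊎_; inj₁; inj₂)
open import Data.Sum.Function.Propositional using (_⊎-↔_)
open import Data.Unit using (⊤; tt)
open import Function using (_∘_)
open import Function.Bundles using (_↔_; mk↔ₛ′; Inverse)
open import Function.Properties.Inverse using (↔⇒↣; ↔-sym; ↔-trans)
open import Relation.Binary.Construct.Closure.ReflexiveTransitive
  using (Star; ε; _◅_; _◅◅_; gmap)
open import Relation.Binary.Definitions using (DecidableEquality)
open import Relation.Binary.PropositionalEquality
  using (_≡_; _≢_; refl; sym; trans; cong; cong₂; subst)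
open import Relation.Nullary using (Dec; yes; no)

-- A finite set of vertices with half-edges attached, cyclically ordered around
-- each vertex by the successor function σ (counterclockwise).  Half-edges are
-- not yet paired into edges, so that they can be inserted one at a time.
--
-- Going from σ h back to h, `cyclic` shows that σ is onto, hence (finiteness)
-- a permutation; its cycles are exactly the nonempty fibres of `vertex`.
record RotationSystem : Set₁ where
  field
    V H      : Set
    #V #H    : ℕ
    finiteV  : V ↔ Fin #V
    finiteH  : H ↔ Fin #H
    vertex   : H → V
    σ        : H → H
    σ-vertex : ∀ h → vertex (σ h) ≡ vertex h
    cyclic   : ∀ h h′ → vertex h ≡ vertex h′ → Star (λ x y → σ x ≡ y) h h′

  _≟ᴴ_ : DecidableEquality H
  _≟ᴴ_ = inj⇒≟ (↔⇒↣ finiteH)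

-- `before h` is the corner between the half-edge preceding h and h itself, so h
-- is the half-edge that follows this corner.  A vertex without half-edges has a
-- single corner.
data Corner (S : RotationSystem) : Set where
  before   : RotationSystem.H S → Corner S
  isolated : (v : RotationSystem.V S) → (∀ h → RotationSystem.vertex S h ≢ v) → Corner S

cornerVertex : (S : RotationSystem) → Corner S → RotationSystem.V S
cornerVertex S (before h)     = RotationSystem.vertex S h
cornerVertex S (isolated v _) = v

private
  Maybe-↔ : ∀ {A : Set} {n} → A ↔ Fin n → Maybe A ↔ Fin (suc n)
  Maybe-↔ {A} {n} e = mk↔ₛ′ f g f∘g g∘f
    where
    f : Maybe A → Fin (suc n)
    f nothing  = zero
    f (just a) = suc (Inverse.to e a)
    g : Fin (suc n) → Maybe A
    g zero    = nothing
    g (suc i) = just (Inverse.from e i)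
    f∘g : ∀ i → f (g i) ≡ i
    f∘g zero    = refl
    f∘g (suc i) = cong suc (Inverse.strictlyInverseˡ e i)
    g∘f : ∀ a → g (f a) ≡ a
    g∘f nothing  = refl
    g∘f (just a) = cong just (Inverse.strictlyInverseʳ e a)

-- Insertion of one half-edge, `nothing`, in a corner.
module Insertion (S : RotationSystem) where
  open RotationSystem S

  redirect : ∀ {x y : H} → Dec (x ≡ y) → Maybe H
  redirect         (yes _) = nothing
  redirect {x = x} (no _)  = just x

  σ⁺ : Corner S → Maybe H → Maybe H
  σ⁺ (before h)     nothing  = just h
  σ⁺ (before h)     (just x) = redirect (σ x ≟ᴴ h)
  σ⁺ (isolated _ _) nothing  = nothing
  σ⁺ (isolated _ _) (just x) = just (σ x)

  vertex⁺ : Corner S → Maybe H → V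
  vertex⁺ c = maybe′ vertex (cornerVertex S c)

  σ⁺-vertex : ∀ c x → vertex⁺ c (σ⁺ c x) ≡ vertex⁺ c x
  σ⁺-vertex (before h) nothing = refl
  σ⁺-vertex (before h) (just x) with σ x ≟ᴴ h
  ... | yes refl = σ-vertex x
  ... | no  _    = σ-vertex x
  σ⁺-vertex (isolated _ _) nothing  = refl
  σ⁺-vertex (isolated _ _) (just x) = σ-vertex x

  private
    module _ (h : H) where
      _↝_ : Maybe H → Maybe H → Set
      _↝_ = Star (λ x y → σ⁺ (before h) x ≡ y)

      step : ∀ x → just x ↝ just (σ x)
      step x with σ x ≟ᴴ h in eq
      ... | yes refl = cong redirect eq ◅ refl ◅ ε
      ... | no  _    = cong redirect eq ◅ ε

      lift : ∀ {x y} → Star (λ x y → σ x ≡ y) x y → just x ↝ just y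
      lift ε            = ε
      lift (refl ◅ xys) = step _ ◅◅ lift xys

      toNew : ∀ x → Star (λ x y → σ x ≡ y) (σ x) h → just x ↝ nothing
      toNew x xs with σ x ≟ᴴ h in eq
      toNew x xs            | yes _   = cong redirect eq ◅ ε
      toNew x ε             | no  x≢h = ⊥-elim (x≢h refl)
      toNew x (refl ◅ xs)   | no  _   = cong redirect eq ◅ toNew (σ x) xs

  cyclic⁺ : ∀ c x y → vertex⁺ c x ≡ vertex⁺ c y → Star (λ x y → σ⁺ c x ≡ y) x y
  cyclic⁺ (before h) nothing  nothing  _ = refl ◅ toNew h h (cyclic _ _ (σ-vertex h))
  cyclic⁺ (before h) nothing  (just y) p = refl ◅ lift h (cyclic _ _ p)
  cyclic⁺ (before h) (just x) nothing  p = toNew h x (cyclic _ _ (trans (σ-vertex x) p))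
  cyclic⁺ (before h) (just x) (just y) p = lift h (cyclic _ _ p)
  cyclic⁺ (isolated v i) nothing  nothing  _ = ε
  cyclic⁺ (isolated v i) nothing  (just y) p = ⊥-elim (i y (sym p))
  cyclic⁺ (isolated v i) (just x) nothing  p = ⊥-elim (i x p)
  cyclic⁺ (isolated v i) (just x) (just y) p = gmap just (cong just) (cyclic _ _ p)

  insert : Corner S → RotationSystem
  insert c = record
    { V = V ; H = Maybe H ; #V = #V ; #H = suc #H
    ; finiteV  = finiteV
    ; finiteH  = Maybe-↔ finiteH
    ; vertex   = vertex⁺ c
    ; σ        = σ⁺ c
    ; σ-vertex = σ⁺-vertex c
    ; cyclic   = cyclic⁺ c
    }

open Insertion public using (insert)

_⊕_ : RotationSystem → RotationSystem → RotationSystem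
S ⊕ T = record
  { V = S.V ⊎ T.V ; H = S.H ⊎ T.H ; #V = S.#V ℕ.+ T.#V ; #H = S.#H ℕ.+ T.#H
  ; finiteV  = ↔-trans (S.finiteV ⊎-↔ T.finiteV) (↔-sym +↔⊎)
  ; finiteH  = ↔-trans (S.finiteH ⊎-↔ T.finiteH) (↔-sym +↔⊎)
  ; vertex   = Data.Sum.map S.vertex T.vertex
  ; σ        = Data.Sum.map S.σ T.σ
  ; σ-vertex = λ { (inj₁ h) → cong inj₁ (S.σ-vertex h) ; (inj₂ h) → cong inj₂ (T.σ-vertex h) }
  ; cyclic   = λ { (inj₁ h) (inj₁ h′) p → gmap inj₁ (cong inj₁) (S.cyclic h h′ (inj₁-inj p))
                 ; (inj₂ h) (inj₂ h′) p → gmap inj₂ (cong inj₂) (T.cyclic h h′ (inj₂-inj p)) }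
  }
  where
  module S = RotationSystem S
  module T = RotationSystem T
  inj₁-inj : ∀ {x y : S.V} → _≡_ {A = S.V ⊎ T.V} (inj₁ x) (inj₁ y) → x ≡ y
  inj₁-inj refl = refl
  inj₂-inj : ∀ {x y : T.V} → _≡_ {A = S.V ⊎ T.V} (inj₂ x) (inj₂ y) → x ≡ y
  inj₂-inj refl = refl

-- The edges are the n pairs {h , α h}.
record RootedMap (n : ℕ) : Set₁ where
  field
    system : RotationSystem
  open RotationSystem system public
  field
    α           : H → H
    α-involutive : ∀ h → α (α h) ≡ h
    α-fixfree   : ∀ h → α h ≢ h
    edges       : #H ≡ n ℕ.* 2

  Adjacent : V → V → Set
  Adjacent u v = ∃ λ h → vertex h ≡ u × vertex (α h) ≡ v

  field
    connected : ∀ u v → Star Adjacent u v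
    root      : Corner system

  rootVertex : V
  rootVertex = cornerVertex system root

data SameCorner {S T : RotationSystem}
                (f : RotationSystem.V S → RotationSystem.V T)
                (g : RotationSystem.H S → RotationSystem.H T) :
                Corner S → Corner T → Set where
  before   : ∀ {h h′} → g h ≡ h′ → SameCorner f g (before h) (before h′)
  isolated : ∀ {v v′ p p′} → f v ≡ v′ → SameCorner f g (isolated v p) (isolated v′ p′)

infix 4 _≅_

record _≅_ {m n} (M : RootedMap m) (N : RootedMap n) : Set where
  private
    module M = RootedMap M
    module N = RootedMap N
  field
    onV : M.V ↔ N.V
    onH : M.H ↔ N.H
  f = Inverse.to onV
  g = Inverse.to onH
  field
    vertex-comm : ∀ h → N.vertex (g h) ≡ f (M.vertex h)
    σ-comm      : ∀ h → N.σ (g h) ≡ g (M.σ h)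
    α-comm      : ∀ h → N.α (g h) ≡ g (M.α h)
    root-comm   : SameCorner f g M.root N.root

dot : RootedMap 0
dot = record
  { system = record
    { V = ⊤ ; H = ⊥ ; #V = 1 ; #H = 0
    ; finiteV = ↔-sym 1↔⊤ ; finiteH = ↔-sym 0↔⊥
    ; vertex = λ () ; σ = λ () ; σ-vertex = λ () ; cyclic = λ () }
  ; α = λ () ; α-involutive = λ () ; α-fixfree = λ () ; edges = refl
  ; connected = λ _ _ → ε
  ; root = isolated tt λ ()
  }

-- Construction (i): the new edge consists of the half-edges inserted in the two
-- root corners.
join : ∀ {a b} → RootedMap a → RootedMap b → RootedMap (suc (a ℕ.+ b))
join {a} {b} M₁ M₂ = record
  { system = S
  ; α = α ; α-involutive = α-involutive ; α-fixfree = α-fixfree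
  ; edges = cong suc (trans (cong₂ (λ x y → x ℕ.+ suc y) M₁.edges M₂.edges)
                     (trans (+-suc (a ℕ.* 2) (b ℕ.* 2))
                            (cong suc (sym (*-distribʳ-+ 2 a b)))))
  ; connected = connected
  ; root = before (inj₁ nothing)
  }
  where
  module M₁ = RootedMap M₁
  module M₂ = RootedMap M₂
  S = insert M₁.system M₁.root ⊕ insert M₂.system M₂.root
  open RotationSystem S using (H; V; vertex)

  α : H → H
  α (inj₁ nothing)  = inj₂ nothing
  α (inj₂ nothing)  = inj₁ nothing
  α (inj₁ (just h)) = inj₁ (just (M₁.α h))
  α (inj₂ (just h)) = inj₂ (just (M₂.α h))

  α-involutive : ∀ h → α (α h) ≡ h
  α-involutive (inj₁ nothing)  = refl
  α-involutive (inj₂ nothing)  = refl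
  α-involutive (inj₁ (just h)) = cong (inj₁ ∘ just) (M₁.α-involutive h)
  α-involutive (inj₂ (just h)) = cong (inj₂ ∘ just) (M₂.α-involutive h)

  α-fixfree : ∀ h → α h ≢ h
  α-fixfree (inj₁ (just h)) p = M₁.α-fixfree h (inj₁∘just-inj p)
    where
    inj₁∘just-inj : ∀ {x y} → _≡_ {A = H} (inj₁ (just x)) (inj₁ (just y)) → x ≡ y
    inj₁∘just-inj refl = refl
  α-fixfree (inj₂ (just h)) p = M₂.α-fixfree h (inj₂∘just-inj p)
    where
    inj₂∘just-inj : ∀ {x y} → _≡_ {A = H} (inj₂ (just x)) (inj₂ (just y)) → x ≡ y
    inj₂∘just-inj refl = refl

  _~_ : V → V → Set
  u ~ v = ∃ λ h → vertex h ≡ u × vertex (α h) ≡ v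

  in₁ : ∀ u v → Star _~_ (inj₁ u) (inj₁ v)
  in₁ u v = gmap inj₁ (λ { (h , p , q) → inj₁ (just h) , cong inj₁ p , cong inj₁ q })
                      (M₁.connected u v)

  in₂ : ∀ u v → Star _~_ (inj₂ u) (inj₂ v)
  in₂ u v = gmap inj₂ (λ { (h , p , q) → inj₂ (just h) , cong inj₂ p , cong inj₂ q })
                      (M₂.connected u v)

  connected : ∀ u v → Star _~_ u v
  connected (inj₁ u) (inj₁ v) = in₁ u v
  connected (inj₂ u) (inj₂ v) = in₂ u v
  connected (inj₁ u) (inj₂ v) =
    in₁ u M₁.rootVertex ◅◅ (inj₁ nothing , refl , refl) ◅ in₂ M₂.rootVertex v
  connected (inj₂ u) (inj₁ v) =
    in₂ u M₂.rootVertex ◅◅ (inj₂ nothing , refl , refl) ◅ in₁ M₁.rootVertex v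

-- M₀ with a half-edge dangling in its root corner: the root corner is thereby
-- split in two (unless M₀ has no edge), whence 2n-1 corners if M₀ has n-1 edges.
withRootLeg : ∀ {n} → RootedMap n → RotationSystem
withRootLeg M₀ = insert (RootedMap.system M₀) (RootedMap.root M₀)

-- Construction (ii): the half-edge inserted in the old root corner is
-- `just nothing`, the other end of the new edge is `nothing`.
addEdge : ∀ {n} (M₀ : RootedMap n) → Corner (withRootLeg M₀) → RootedMap (suc n)
addEdge {n} M₀ c = record
  { system = insert (withRootLeg M₀) c
  ; α = α ; α-involutive = α-involutive ; α-fixfree = α-fixfree
  ; edges = cong (λ h → suc (suc h)) M₀.edges
  ; connected = λ u v →
      gmap (λ w → w) (λ { (h , p , q) → just (just h) , p , q }) (M₀.connected u v)
  ; root = before (just nothing)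
  }
  where
  module M₀ = RootedMap M₀

  α : Maybe (Maybe M₀.H) → Maybe (Maybe M₀.H)
  α nothing         = just nothing
  α (just nothing)  = nothing
  α (just (just h)) = just (just (M₀.α h))

  α-involutive : ∀ h → α (α h) ≡ h
  α-involutive nothing         = refl
  α-involutive (just nothing)  = refl
  α-involutive (just (just h)) = cong (just ∘ just) (M₀.α-involutive h)

  α-fixfree : ∀ h → α h ≢ h
  α-fixfree (just (just h)) p = M₀.α-fixfree h (just∘just-inj p)
    where
    just∘just-inj : ∀ {x y : M₀.H} → just (just x) ≡ just (just y) → x ≡ y
    just∘just-inj refl = refl

-- RootIsthmicParts M k : c(M) = k.
data RootIsthmicParts : ∀ {n} → RootedMap n → ℕ → Set₁ where
  edgeless   : (M : RootedMap 0) → RootIsthmicParts M 0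
  isthmic    : ∀ {n a b k} {M : RootedMap n} (M₁ : RootedMap a) (M₂ : RootedMap b) →
                M ≅ join M₁ M₂ → RootIsthmicParts M₁ k → RootIsthmicParts M (suc k)
  nonIsthmic : ∀ {n m k} {M : RootedMap n} (M₀ : RootedMap m) (c : Corner (withRootLeg M₀)) →
                M ≅ addEdge M₀ c → RootIsthmicParts M₀ k → RootIsthmicParts M k

-- The uniform probability space of rooted maps with n edges up to isomorphism,
-- given by one representative per isomorphism class, with the random variable c.
record UniformRootedMap (n : ℕ) : Set₁ where
  field
    size        : ℕ
    map         : Fin size → RootedMap n
    complete    : ∀ (M : RootedMap n) → ∃ λ i → M ≅ map i
    irredundant : ∀ i j → map i ≅ map j → i ≡ j
    c           : Fin size → ℕ
    c-correct   : ∀ i → RootIsthmicParts (map i) (c i)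

loops : ∀ n → RootedMap n
loops zero    = dot
loops (suc n) = addEdge (loops n) (before nothing)

size-nonZero : ∀ {n} (Ω : UniformRootedMap n) → ℕ.NonZero (UniformRootedMap.size Ω)
size-nonZero {n} Ω = inhabited (proj₁ (UniformRootedMap.complete Ω (loops n)))
  where
  inhabited : ∀ {s} → Fin s → ℕ.NonZero s
  inhabited {suc _} _ = _

-- Distributions on ℕ are given by their mass functions.
law-of-c : ∀ {n} → UniformRootedMap n → ℕ → ℚ
law-of-c Ω k = ℚ._/_ (+ length (filter (λ i → c i ℕ.≟ k) (allFin size))) size
                     {{size-nonZero Ω}}
  where open UniformRootedMap Ω

½^_ : ℕ → ℚ
½^ zero  = ℚ.1ℚ
½^ suc k = ½ ℚ.* ½^ k

geometric½ : ℕ → ℚ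
geometric½ zero        = 0ℚ
geometric½ k@(suc _)   = ½^ k

sumUpTo : (ℕ → ℚ) → ℤ → ℚ
sumUpTo p -[1+ _ ]    = 0ℚ
sumUpTo p (+ zero)    = p zero
sumUpTo p (+ (suc k)) = sumUpTo p (+ k) ℚ.+ p (suc k)

cdf : (ℕ → ℚ) → ℚ → ℚ
cdf p x = sumUpTo p (floor x)

ContinuousAt : (ℚ → ℚ) → ℚ → Set
ContinuousAt F x = ∀ ε → 0ℚ ℚ.< ε → ∃ λ δ → 0ℚ ℚ.< δ ×
  (∀ y → ℚ.∣ y ℚ.- x ∣ ℚ.< δ → ℚ.∣ F y ℚ.- F x ∣ ℚ.< ε)

Converges : (ℕ → ℚ) → ℚ → Set
Converges s l = ∀ ε → 0ℚ ℚ.< ε → ∃ λ N → ∀ n → n ≥ N → ℚ.∣ s n ℚ.- l ∣ ℚ.< ε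

infix 4 _⟶ᵈ_

-- Distribution functions are monotone, so testing at the rational continuity
-- points, which are dense, is the same as testing at all real ones.
_⟶ᵈ_ : (ℕ → ℕ → ℚ) → (ℕ → ℚ) → Set
p ⟶ᵈ q = ∀ x → ContinuousAt (cdf q) x → Converges (λ n → cdf (p n) x) (cdf q x)

module Submission where

-- A rooted map with a root edge e is, up to isomorphism, either a join or an edge addition, in one
-- way only: e is an isthmus iff its ends are not linked by the other edges, and rooted maps have no
-- nontrivial automorphisms.  So the numbers a n of rooted maps with n edges and A n k of those with
-- c = k satisfy
--   a (n+1) = Σ a i · a (n-i) + (2n+1) · a n,   A (n+1) (k+1) = Σ A i k · a (n-i) + (2n+1) · A n (k+1).
-- In the sums only the two end terms matter: the others contribute O((2n)!!), because
-- a n ≤ (2n+1)!!.  With |A n k / a n - 2⁻ᵏ| replaced by |2ᵏ · A n k - a n| the error recurrence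
-- reads E (n+1) ≤ (2n+1) · E n + O((2n)!!), hence E n = O((2n)!!) by induction on k and n, and
-- (2n)!! / a n = O(n^(-1/2)) since (n+1) · (2n)!!² ≤ (2n+1)!!² ≤ 4 · a n².

open import Axiom.UniquenessOfIdentityProofs using (module Decidable⇒UIP)
open import Data.Bool using (Bool; true; false; _∨_)
import Data.Bool.Properties as Bool
open import Data.Empty using (⊥; ⊥-elim)
open import Data.Fin as Fin using (Fin; zero; suc; cast)
open import Data.Fin.Permutation using (transpose; ↔⇒≡)
open import Data.Fin.Properties as Fin using (pigeonhole; +↔⊎; *↔×; 0↔⊥; 1↔⊤; <-cmp)
open import Data.Integer as ℤ using (-[1+_])
import Data.Integer.Properties as ℤ
open import Data.List using (allFin; filter; length; tabulate)
open import Data.List.Properties using (length-filter; length-tabulate)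
open import Data.Maybe as Maybe using (Maybe; just; nothing)
open import Data.Maybe.Properties using (just-injective)
open import Data.Nat as ℕ using (ℕ; zero; suc; _+_; _*_; _^_; _≤_; _<_; z≤n; s≤s; NonZero)
open import Data.Nat.Induction using (<-rec)
import Data.Nat.Properties as ℕ
open import Data.Nat.Tactic.RingSolver using (solve-∀)
open import Data.Product using (∃; Σ; _×_; _,_; proj₁; proj₂)
open import Data.Product.Function.NonDependent.Propositional using (_×-↔_)
open import Data.Rational as ℚ using (ℚ; mkℚ; 0ℚ; ½; floor; toℚᵘ)
import Data.Rational.Properties as ℚ
import Data.Rational.Solver as ℚ-Solver
open import Data.Rational.Unnormalised as ℚᵘ using (mkℚᵘ; *<*)
import Data.Rational.Unnormalised.Properties as ℚᵘ
open import Data.Sum as Sum using (_⊎_; inj₁; inj₂)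
open import Data.Sum.Function.Propositional using (_⊎-↔_)
open import Data.Sum.Properties using (inj₁-injective; inj₂-injective)
open import Data.Unit using (⊤; tt)
open import Function using (_∘_; id)
open import Function.Bundles using (_↔_; mk↔ₛ′; Inverse)
open import Function.Definitions using (Injective)
open import Function.Properties.Inverse using (↔⇒↣; ↔-refl; ↔-sym; ↔-trans)
open import Relation.Binary.Construct.Closure.ReflexiveTransitive using (Star; ε; _◅_; _◅◅_; gmap; reverse)
open import Relation.Binary.Definitions using (DecidableEquality; Tri; tri<; tri≈; tri>)
open import Relation.Binary.PropositionalEquality using (_≡_; _≢_; refl; sym; trans; cong; cong₂; subst; subst₂; module ≡-Reasoning)
open import Relation.Nullary using (Dec; yes; no; ¬_; contradiction)
open import Relation.Nullary.Decidable using (does; _×-dec_; ¬?)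
open import Relation.Unary using (Decidable; Irrelevant)
open import Defs

open Inverse using (to; from; strictlyInverseˡ; strictlyInverseʳ)
open RotationSystem using (V; H; vertex; σ; σ-vertex; cyclic; finiteV; finiteH)
open Insertion using (σ⁺; vertex⁺; redirect)

-- The ratio 1/2 comes from the coefficients. With its two end terms, each `a n`, the recurrence for
-- `a` reads a (n+1) = (2n+3) · a n + ..., whereas A (n+1) (k+1) keeps the coefficient 2n+1 and
-- receives A n k. If A n k is about x k · a n with k ≥ 1, this forces (2n+3) · x (k+1) = (2n+1) · x
-- (k+1) + x k, that is x (k+1) = x k / 2. For k = 0 the source is a n itself, up to a negligible
-- term: it counts the joins of the one-vertex map to an arbitrary map, and starts the geometric
-- sequence at x 1 = 1/2. The obstacle on the combinatorial side is that the representatives in Ω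
-- are arbitrary and `c` is known only through a relation. Hence decomposition, cancellation and
-- single-valuedness of `c` all have to be proved up to isomorphism before anything can be counted.

to-injective : ∀ {A B : Set} (e : A ↔ B) → Injective _≡_ _≡_ (to e)
to-injective e {x} {y} p =
  trans (sym (strictlyInverseʳ e x)) (trans (cong (from e) p) (strictlyInverseʳ e y))

Maybe-↔ : {A B : Set} → A ↔ B → Maybe A ↔ Maybe B
Maybe-↔ e = mk↔ₛ′ (Maybe.map (to e)) (Maybe.map (from e))
  (λ { nothing → refl ; (just b) → cong just (strictlyInverseˡ e b) })
  (λ { nothing → refl ; (just a) → cong just (strictlyInverseʳ e a) })

module Restriction {A B X Y : Set} (e : X ↔ Y) {ι : A → X} {κ : B → Y}
                (ι-inj : Injective _≡_ _≡_ ι) (κ-inj : Injective _≡_ _≡_ κ)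
                (f : ∀ a → ∃ λ b → to e (ι a) ≡ κ b) (g : ∀ b → ∃ λ a → from e (κ b) ≡ ι a) where

  restrict : A ↔ B
  restrict = mk↔ₛ′ (proj₁ ∘ f) (proj₁ ∘ g)
    (λ b → κ-inj (trans (sym (proj₂ (f _))) (trans (cong (to e) (sym (proj₂ (g b)))) (strictlyInverseˡ e _))))
    (λ a → ι-inj (trans (sym (proj₂ (g _))) (trans (cong (from e) (sym (proj₂ (f a)))) (strictlyInverseʳ e _))))

-- Isomorphisms of rotation systems and rooted maps, and cancellation of `addEdge`

infix 4 _≃_

record _≃_ (S T : RotationSystem) : Set where
  field
    onV : V S ↔ V T
    onH : H S ↔ H T
    vertex-comm : ∀ h → vertex T (to onH h) ≡ to onV (vertex S h)
    σ-comm      : ∀ h → σ T (to onH h) ≡ to onH (σ S h)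

SameCorner≃ : ∀ {S T} → S ≃ T → Corner S → Corner T → Set
SameCorner≃ φ = SameCorner (to (_≃_.onV φ)) (to (_≃_.onH φ))

≃-refl : ∀ {S} → S ≃ S
≃-refl = record { onV = ↔-refl ; onH = ↔-refl ; vertex-comm = λ _ → refl ; σ-comm = λ _ → refl }

≃-sym : ∀ {S T} → S ≃ T → T ≃ S
≃-sym {S} {T} φ = record
  { onV = ↔-sym onV ; onH = ↔-sym onH
  ; vertex-comm = λ h → to-injective onV (trans (sym (vertex-comm _))
      (trans (cong (vertex T) (strictlyInverseˡ onH h)) (sym (strictlyInverseˡ onV _))))
  ; σ-comm = λ h → to-injective onH (trans (sym (σ-comm _))
      (trans (cong (σ T) (strictlyInverseˡ onH h)) (sym (strictlyInverseˡ onH _)))) }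
  where open _≃_ φ

≃-trans : ∀ {S T U} → S ≃ T → T ≃ U → S ≃ U
≃-trans φ ψ = record
  { onV = ↔-trans φ.onV ψ.onV ; onH = ↔-trans φ.onH ψ.onH
  ; vertex-comm = λ h → trans (ψ.vertex-comm _) (cong (to ψ.onV) (φ.vertex-comm h))
  ; σ-comm = λ h → trans (ψ.σ-comm _) (cong (to ψ.onH) (φ.σ-comm h)) }
  where
  module φ = _≃_ φ
  module ψ = _≃_ ψ

SameCorner-sym : ∀ {S T} (φ : S ≃ T) {c d} → SameCorner≃ φ c d → SameCorner≃ (≃-sym φ) d c
SameCorner-sym φ (before refl)   = before (strictlyInverseʳ (_≃_.onH φ) _)
SameCorner-sym φ (isolated refl) = isolated (strictlyInverseʳ (_≃_.onV φ) _)

SameCorner-trans : ∀ {S T U} (φ : S ≃ T) (ψ : T ≃ U) {b c d} →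
                   SameCorner≃ φ b c → SameCorner≃ ψ c d → SameCorner≃ (≃-trans φ ψ) b d
SameCorner-trans φ ψ (before refl)   (before refl)   = before refl
SameCorner-trans φ ψ (isolated refl) (isolated refl) = isolated refl

image : ∀ {S T} (φ : S ≃ T) (c : Corner S) → ∃ λ d → SameCorner≃ φ c d
image φ (before h)     = before (to (_≃_.onH φ) h) , before refl
image {S} {T} φ (isolated v i) = isolated (to onV v) i′ , isolated refl
  where
  open _≃_ φ
  i′ : ∀ h → vertex T h ≢ to onV v
  i′ h p = i (from onH h) (to-injective onV (trans (sym (vertex-comm _))
             (trans (cong (vertex T) (strictlyInverseˡ onH h)) p)))

cornerVertex-comm : ∀ {S T} (φ : S ≃ T) {c d} → SameCorner≃ φ c d →
                    cornerVertex T d ≡ to (_≃_.onV φ) (cornerVertex S c)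
cornerVertex-comm φ (before refl)   = _≃_.vertex-comm φ _
cornerVertex-comm φ (isolated refl) = refl

insert-cong : ∀ {S T} (φ : S ≃ T) {c d} → SameCorner≃ φ c d → insert S c ≃ insert T d
insert-cong {S} {T} φ {c} {d} cd = record
  { onV = onV ; onH = Maybe-↔ onH ; vertex-comm = vertex-comm⁺ ; σ-comm = σ-comm⁺ cd }
  where
  open _≃_ φ
  vertex-comm⁺ : ∀ h → vertex⁺ T d (Maybe.map (to onH) h) ≡ to onV (vertex⁺ S c h)
  vertex-comm⁺ nothing  = cornerVertex-comm φ cd
  vertex-comm⁺ (just h) = vertex-comm h

  σ-comm⁺ : ∀ {c d} → SameCorner≃ φ c d →
            ∀ h → σ⁺ T d (Maybe.map (to onH) h) ≡ Maybe.map (to onH) (σ⁺ S c h)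
  σ-comm⁺ (before refl) nothing = refl
  σ-comm⁺ (before {h} refl) (just x)
    with RotationSystem._≟ᴴ_ T (σ T (to onH x)) (to onH h) | RotationSystem._≟ᴴ_ S (σ S x) h
  ... | yes p | yes q = refl
  ... | yes p | no q  = contradiction (to-injective onH (trans (sym (σ-comm x)) p)) q
  ... | no p  | yes q = contradiction (trans (σ-comm x) (cong (to onH) q)) p
  ... | no p  | no q  = cong just (σ-comm x)
  σ-comm⁺ (isolated refl) nothing  = refl
  σ-comm⁺ (isolated refl) (just x) = cong just (σ-comm x)

-- The successor in S is recovered from the one after insertion by skipping the new half-edge.
σ⁺-skip : ∀ S c h → σ⁺ S c (just h) ≡ just (σ S h)
                  ⊎ σ⁺ S c (just h) ≡ nothing × σ⁺ S c nothing ≡ just (σ S h)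
σ⁺-skip S (before k) h with RotationSystem._≟ᴴ_ S (σ S h) k
... | yes refl = inj₂ (refl , refl)
... | no _     = inj₁ refl
σ⁺-skip S (isolated _ _) h = inj₁ refl

-- Converse of `insert-cong`. An isomorphism that fixes the new half-edge restricts to the old ones,
-- whose successor is the inserted one with the new half-edge skipped. The corner is read off from
-- the successor of the new half-edge, which is the new half-edge itself exactly in the isolated
-- case.
module InsertCancel {S T c d} (ψ : insert S c ≃ insert T d)
                    (fixed : to (_≃_.onH ψ) nothing ≡ nothing) where
  open _≃_ ψ

  to-just : ∀ h → ∃ λ k → to onH (just h) ≡ just k
  to-just h with to onH (just h) in eq
  ... | just k  = k , refl
  ... | nothing = contradiction (to-injective onH (trans eq (sym fixed))) λ ()

  from-just : ∀ k → ∃ λ h → from onH (just k) ≡ just h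
  from-just k with from onH (just k) in eq
  ... | just h  = h , refl
  ... | nothing = contradiction (trans (sym (strictlyInverseˡ onH (just k))) (trans (cong (to onH) eq) fixed)) λ ()

  onH⁻ : H S ↔ H T
  onH⁻ = Restriction.restrict onH just-injective just-injective to-just from-just

  to-onH : ∀ h → to onH (just h) ≡ just (to onH⁻ h)
  to-onH h = proj₂ (to-just h)

  σ-nothing : σ⁺ T d nothing ≡ to onH (σ⁺ S c nothing)
  σ-nothing = trans (cong (σ⁺ T d) (sym fixed)) (σ-comm nothing)

  σ-just : ∀ h → σ⁺ T d (just (to onH⁻ h)) ≡ to onH (σ⁺ S c (just h))
  σ-just h = trans (cong (σ⁺ T d) (sym (to-onH h))) (σ-comm (just h))

  cancel : S ≃ T
  cancel = record
    { onV = onV ; onH = onH⁻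
    ; vertex-comm = λ h → trans (cong (vertex⁺ T d) (sym (to-onH h))) (vertex-comm (just h))
    ; σ-comm = σ-comm⁻ }
    where
    σ-comm⁻ : ∀ h → σ T (to onH⁻ h) ≡ to onH⁻ (σ S h)
    -- The skips on the two sides occur together, because `onH` sends `nothing`, and nothing else,
    -- to `nothing`.
    σ-comm⁻ h with σ⁺-skip S c h | σ⁺-skip T d (to onH⁻ h)
    ... | inj₁ p | inj₁ q = just-injective (trans (sym q) (trans (σ-just h) (trans (cong (to onH) p) (to-onH _))))
    ... | inj₁ p | inj₂ (q , _) = contradiction (trans (sym q) (trans (σ-just h) (trans (cong (to onH) p) (to-onH _)))) λ ()
    ... | inj₂ (p , _) | inj₁ q = contradiction (trans (sym q) (trans (σ-just h) (trans (cong (to onH) p) fixed))) λ ()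
    ... | inj₂ (_ , p) | inj₂ (_ , q) = just-injective (trans (sym q) (trans σ-nothing (trans (cong (to onH) p) (to-onH _))))

  sameCorner : SameCorner≃ cancel c d
  sameCorner = same c d σ-nothing vertex-nothing
    where
    vertex-nothing : cornerVertex T d ≡ to onV (cornerVertex S c)
    vertex-nothing = trans (cong (vertex⁺ T d) (sym fixed)) (vertex-comm nothing)
    same : ∀ c d → σ⁺ T d nothing ≡ to onH (σ⁺ S c nothing) →
           cornerVertex T d ≡ to onV (cornerVertex S c) → SameCorner≃ cancel c d
    same (before h)     (before k)     p _ = before (just-injective (sym (trans p (to-onH h))))
    same (before h)     (isolated _ _) p _ = contradiction (trans p (to-onH h)) λ ()
    same (isolated _ _) (before k)     p _ = contradiction (trans p fixed) λ ()
    same (isolated _ _) (isolated _ _) _ q = isolated (sym q)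

⊕-cong : ∀ {S S′ T T′} → S ≃ S′ → T ≃ T′ → S ⊕ T ≃ S′ ⊕ T′
⊕-cong φ ψ = record
  { onV = φ.onV ⊎-↔ ψ.onV ; onH = φ.onH ⊎-↔ ψ.onH
  ; vertex-comm = λ { (inj₁ h) → cong inj₁ (φ.vertex-comm h) ; (inj₂ h) → cong inj₂ (ψ.vertex-comm h) }
  ; σ-comm = λ { (inj₁ h) → cong inj₁ (φ.σ-comm h) ; (inj₂ h) → cong inj₂ (ψ.σ-comm h) } }
  where
  module φ = _≃_ φ
  module ψ = _≃_ ψ

≅⇒≃ : ∀ {m n} {M : RootedMap m} {N : RootedMap n} → M ≅ N → RootedMap.system M ≃ RootedMap.system N
≅⇒≃ φ = record { onV = onV ; onH = onH ; vertex-comm = vertex-comm ; σ-comm = σ-comm }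
  where open _≅_ φ

≃⇒≅ : ∀ {m n} {M : RootedMap m} {N : RootedMap n} (φ : RootedMap.system M ≃ RootedMap.system N) →
      (∀ h → RootedMap.α N (to (_≃_.onH φ) h) ≡ to (_≃_.onH φ) (RootedMap.α M h)) →
      SameCorner≃ φ (RootedMap.root M) (RootedMap.root N) → M ≅ N
≃⇒≅ φ α-comm root-comm = record
  { onV = onV ; onH = onH ; vertex-comm = vertex-comm ; σ-comm = σ-comm ; α-comm = α-comm ; root-comm = root-comm }
  where open _≃_ φ

≅-refl : ∀ {n} {M : RootedMap n} → M ≅ M
≅-refl {M = M} = ≃⇒≅ ≃-refl (λ _ → refl) (same (RootedMap.root M))
  where
  same : ∀ c → SameCorner≃ ≃-refl c c
  same (before _)     = before refl
  same (isolated _ _) = isolated refl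

≅-sym : ∀ {m n} {M : RootedMap m} {N : RootedMap n} → M ≅ N → N ≅ M
≅-sym {M = M} {N} φ = ≃⇒≅ (≃-sym (≅⇒≃ φ))
  (λ h → to-injective onH (trans (sym (α-comm _))
      (trans (cong (RootedMap.α N) (strictlyInverseˡ onH h)) (sym (strictlyInverseˡ onH _)))))
  (SameCorner-sym (≅⇒≃ φ) root-comm)
  where open _≅_ φ

≅-trans : ∀ {l m n} {L : RootedMap l} {M : RootedMap m} {N : RootedMap n} → L ≅ M → M ≅ N → L ≅ N
≅-trans φ ψ = ≃⇒≅ (≃-trans (≅⇒≃ φ) (≅⇒≃ ψ))
  (λ h → trans (ψ.α-comm _) (cong (to ψ.onH) (φ.α-comm h)))
  (SameCorner-trans (≅⇒≃ φ) (≅⇒≃ ψ) φ.root-comm ψ.root-comm)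
  where
  module φ = _≅_ φ
  module ψ = _≅_ ψ

join-cong : ∀ {a a′ b b′} {M₁ : RootedMap a} {N₁ : RootedMap a′} {M₂ : RootedMap b} {N₂ : RootedMap b′} →
            M₁ ≅ N₁ → M₂ ≅ N₂ → join M₁ M₂ ≅ join N₁ N₂
join-cong φ ψ = ≃⇒≅ (⊕-cong (insert-cong (≅⇒≃ φ) φ.root-comm) (insert-cong (≅⇒≃ ψ) ψ.root-comm))
  (λ { (inj₁ nothing) → refl ; (inj₂ nothing) → refl
     ; (inj₁ (just h)) → cong (inj₁ ∘ just) (φ.α-comm h) ; (inj₂ (just h)) → cong (inj₂ ∘ just) (ψ.α-comm h) })
  (before refl)
  where
  module φ = _≅_ φ
  module ψ = _≅_ ψ

withRootLeg-cong : ∀ {m n} {M : RootedMap m} {N : RootedMap n} → M ≅ N → withRootLeg M ≃ withRootLeg N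
withRootLeg-cong φ = insert-cong (≅⇒≃ φ) (_≅_.root-comm φ)

addEdge-cong : ∀ {m n} {M : RootedMap m} {N : RootedMap n} (φ : M ≅ N) {c d} →
               SameCorner≃ (withRootLeg-cong φ) c d → addEdge M c ≅ addEdge N d
addEdge-cong φ cd = ≃⇒≅ (insert-cong (withRootLeg-cong φ) cd)
  (λ { nothing → refl ; (just nothing) → refl ; (just (just h)) → cong (just ∘ just) (α-comm h) })
  (before refl)
  where open _≅_ φ

-- The half-edge `just nothing` is fixed because it carries the root, and `nothing` because it is
-- the α-image of that one. So both insertions cancel, the later one first.
addEdge-cancel : ∀ {m n} {M : RootedMap m} {N : RootedMap n} {c d} → addEdge M c ≅ addEdge N d →
                 Σ (M ≅ N) λ φ → SameCorner≃ (withRootLeg-cong φ) c d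
addEdge-cancel {M = M} {N} {c} {d} ψ = iso , same outer.sameCorner
  where
  open _≅_ ψ
  module M = RootedMap M
  module N = RootedMap N
  module M⁺ = RootedMap (addEdge M c)
  module N⁺ = RootedMap (addEdge N d)
  leg-fixed : to onH (just nothing) ≡ just nothing
  leg-fixed with before p ← root-comm = p
  end-fixed : to onH nothing ≡ nothing
  end-fixed = trans (sym (α-comm (just nothing))) (cong N⁺.α leg-fixed)
  module outer = InsertCancel {withRootLeg M} {withRootLeg N} {c} {d} (≅⇒≃ ψ) end-fixed
  module inner = InsertCancel {M.system} {N.system} {M.root} {N.root} outer.cancel (just-injective (trans (sym (outer.to-onH nothing)) leg-fixed))
  core : M.H → N.H
  core = to inner.onH⁻
  to-onH² : ∀ h → to onH (just (just h)) ≡ just (just (core h))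
  to-onH² h = trans (outer.to-onH (just h)) (cong just (inner.to-onH h))
  iso : M ≅ N
  iso = ≃⇒≅ inner.cancel
    (λ h → just-injective (just-injective
      (trans (cong N⁺.α (sym (to-onH² h))) (trans (α-comm (just (just h))) (to-onH² (M.α h))))))
    inner.sameCorner
  -- `outer.cancel` and `withRootLeg-cong iso` are different terms that act alike on half-edges, so
  -- corners that match under the first match under the second.
  to-leg : ∀ x → Maybe.map core x ≡ to (_≃_.onH outer.cancel) x
  to-leg nothing  = sym (just-injective (trans (sym (outer.to-onH nothing)) leg-fixed))
  to-leg (just h) = sym (inner.to-onH h)
  same : ∀ {c d} → SameCorner≃ outer.cancel c d → SameCorner≃ (withRootLeg-cong iso) c d
  same (before refl) = before (to-leg _)
  same (isolated p)  = isolated p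

-- A union of vertices of X together with all their half-edges.
record _↪_ (S X : RotationSystem) : Set where
  field
    onV : V S → V X
    onH : H S → H X
    onV-injective : Injective _≡_ _≡_ onV
    onH-injective : Injective _≡_ _≡_ onH
    vertex-comm : ∀ h → vertex X (onH h) ≡ onV (vertex S h)
    σ-comm      : ∀ h → σ X (onH h) ≡ onH (σ S h)
    full        : ∀ x v → vertex X x ≡ onV v → ∃ λ h → x ≡ onH h

-- Only vertices need to be tracked: by `full`, the half-edges follow them.
module Subsystem {S T X Y} (φ : X ≃ Y) (i : S ↪ X) (j : T ↪ Y)
                 (f : ∀ v → ∃ λ w → to (_≃_.onV φ) (_↪_.onV i v) ≡ _↪_.onV j w)
                 (g : ∀ w → ∃ λ v → from (_≃_.onV φ) (_↪_.onV j w) ≡ _↪_.onV i v) where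
  private
    module φ = _≃_ φ
    module φ⁻¹ = _≃_ (≃-sym φ)
    module i = _↪_ i
    module j = _↪_ j

  fH : ∀ h → ∃ λ k → to φ.onH (i.onH h) ≡ j.onH k
  fH h = j.full _ _ (trans (φ.vertex-comm _) (trans (cong (to φ.onV) (i.vertex-comm h)) (proj₂ (f (vertex S h)))))

  gH : ∀ k → ∃ λ h → from φ.onH (j.onH k) ≡ i.onH h
  gH k = i.full _ _ (trans (φ⁻¹.vertex-comm _) (trans (cong (from φ.onV) (j.vertex-comm k)) (proj₂ (g (vertex T k)))))

  restriction : S ≃ T
  restriction = record
    { onV = Restriction.restrict φ.onV i.onV-injective j.onV-injective f g
    ; onH = Restriction.restrict φ.onH i.onH-injective j.onH-injective fH gH
    ; vertex-comm = λ h → j.onV-injective (trans (sym (j.vertex-comm _)) (trans (cong (vertex Y) (sym (proj₂ (fH h))))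
        (trans (φ.vertex-comm _) (trans (cong (to φ.onV) (i.vertex-comm h)) (proj₂ (f (vertex S h)))))))
    ; σ-comm = λ h → j.onH-injective (trans (sym (j.σ-comm _)) (trans (cong (σ Y) (sym (proj₂ (fH h))))
        (trans (φ.σ-comm _) (trans (cong (to φ.onH) (i.σ-comm h)) (proj₂ (fH (σ S h))))))) }

  to-onH : ∀ h → to φ.onH (i.onH h) ≡ j.onH (to (_≃_.onH restriction) h)
  to-onH h = proj₂ (fH h)

⊕-left : ∀ {S T} → S ↪ (S ⊕ T)
⊕-left = record
  { onV = inj₁ ; onH = inj₁ ; onV-injective = inj₁-injective ; onH-injective = inj₁-injective
  ; vertex-comm = λ _ → refl ; σ-comm = λ _ → refl
  ; full = λ { (inj₁ h) _ _ → h , refl } }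

⊕-right : ∀ {S T} → T ↪ (S ⊕ T)
⊕-right = record
  { onV = inj₂ ; onH = inj₂ ; onV-injective = inj₂-injective ; onH-injective = inj₂-injective
  ; vertex-comm = λ _ → refl ; σ-comm = λ _ → refl
  ; full = λ { (inj₂ h) _ _ → h , refl } }

-- Isthmuses, cancellation of `join`, rigidity, uniqueness of c

isLeft : {A B : Set} → A ⊎ B → Bool
isLeft (inj₁ _) = true
isLeft (inj₂ _) = false

left : {A B : Set} (x : A ⊎ B) → isLeft x ≡ true → ∃ λ a → x ≡ inj₁ a
left (inj₁ a) _ = a , refl

right : {A B : Set} (x : A ⊎ B) → isLeft x ≡ false → ∃ λ b → x ≡ inj₂ b
right (inj₂ b) _ = b , refl

-- Connectivity without the edge of `r` is expressed inside `M`, so that one can ask whether this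
-- edge is an isthmus before any smaller map has been built.
module Deletion {n} (M : RootedMap n) (r : RootedMap.H M) where
  private module M = RootedMap M

  Kept : M.H → Set
  Kept h = h ≢ r × h ≢ M.α r

  Linked : M.V → M.V → Set
  Linked u v = ∃ λ h → Kept h × M.vertex h ≡ u × M.vertex (M.α h) ≡ v

  Linked-sym : ∀ {u v} → Linked u v → Linked v u
  Linked-sym (h , (p , q) , u , v) =
    M.α h , ((λ e → q (trans (sym (M.α-involutive h)) (cong M.α e)))
          , (λ e → p (trans (sym (M.α-involutive h)) (trans (cong M.α e) (M.α-involutive r)))))
    , v , trans (cong M.vertex (M.α-involutive h)) u

  Path : M.V → M.V → Set
  Path = Star Linked

Path-image : ∀ {m n} {M : RootedMap m} {N : RootedMap n} (φ : M ≅ N) {r s} → to (_≅_.onH φ) r ≡ s →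
             ∀ {u v} → Deletion.Path M r u v → Deletion.Path N s (to (_≅_.onV φ) u) (to (_≅_.onV φ) v)
Path-image {N = N} φ {r} refl = gmap (to onV) λ { (h , (p , q) , refl , refl) →
  to onH h , ((λ e → p (to-injective onH e)) , (λ e → q (to-injective onH (trans e (α-comm r)))))
  , vertex-comm h , trans (cong (RootedMap.vertex N) (α-comm h)) (vertex-comm _) }
  where open _≅_ φ

module _ {a b} (M₁ : RootedMap a) (M₂ : RootedMap b) where
  private
    module M₁ = RootedMap M₁
    module M₂ = RootedMap M₂
  open Deletion (join M₁ M₂) (inj₁ nothing)

  join-path-left : ∀ u v → Path (inj₁ u) (inj₁ v)
  join-path-left u v = gmap inj₁ (λ { (h , refl , refl) → inj₁ (just h) , ((λ ()) , λ ()) , refl , refl }) (M₁.connected u v)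

  join-path-right : ∀ u v → Path (inj₂ u) (inj₂ v)
  join-path-right u v = gmap inj₂ (λ { (h , refl , refl) → inj₂ (just h) , ((λ ()) , λ ()) , refl , refl }) (M₂.connected u v)

  join-path-side : ∀ {u v} → Path u v → isLeft u ≡ isLeft v
  join-path-side ε = refl
  join-path-side ((inj₁ nothing , (p , _) , _) ◅ _) = contradiction refl p
  join-path-side ((inj₂ nothing , (_ , p) , _) ◅ _) = contradiction refl p
  join-path-side ((inj₁ (just _) , _ , refl , refl) ◅ ps) = join-path-side ps
  join-path-side ((inj₂ (just _) , _ , refl , refl) ◅ ps) = join-path-side ps

addEdge-path : ∀ {n} (M₀ : RootedMap n) c u v → Deletion.Path (addEdge M₀ c) (just nothing) u v
addEdge-path M₀ c u v = gmap id (λ { (h , refl , refl) → just (just h) , ((λ ()) , λ ()) , refl , refl }) (RootedMap.connected M₀ u v)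

-- Linkage without the root edge is invariant under isomorphism. In `addEdge M₀ c` it relates all
-- vertices, in `join M₁ M₂` never one from each side.
join≇addEdge : ∀ {a b n} (M₁ : RootedMap a) (M₂ : RootedMap b) (M₀ : RootedMap n) c → ¬ (addEdge M₀ c ≅ join M₁ M₂)
join≇addEdge M₁ M₂ M₀ c φ = contradiction
  (trans (cong isLeft (sym (strictlyInverseˡ onV (inj₁ (RootedMap.rootVertex M₁)))))
    (trans (join-path-side M₁ M₂ (Path-image φ (root-fixed root-comm) (addEdge-path M₀ c _ _)))
           (cong isLeft (strictlyInverseˡ onV (inj₂ (RootedMap.rootVertex M₂)))))) λ ()
  where
  open _≅_ φ
  root-fixed : ∀ {x y} → SameCorner≃ (≅⇒≃ φ) (before x) (before y) → to onH x ≡ y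
  root-fixed (before p) = p

-- The two sides of a join are its classes of vertices linked without the root edge. An isomorphism
-- permutes these classes, and since it fixes both ends of the root edge it does not exchange them.
module JoinSides {a a′ b b′} {M₁ : RootedMap a} {M₂ : RootedMap b} {N₁ : RootedMap a′} {N₂ : RootedMap b′}
                 (φ : join M₁ M₂ ≅ join N₁ N₂) where
  open _≅_ φ

  left-fixed : to onH (inj₁ nothing) ≡ inj₁ nothing
  left-fixed with before p ← root-comm = p

  right-fixed : to onH (inj₂ nothing) ≡ inj₂ nothing
  right-fixed = trans (sym (α-comm (inj₁ nothing))) (cong (RootedMap.α (join N₁ N₂)) left-fixed)

  side : ∀ v → isLeft (to onV v) ≡ isLeft v
  side (inj₁ v) = trans (sym (join-path-side N₁ N₂ (Path-image φ left-fixed (join-path-left M₁ M₂ (RootedMap.rootVertex M₁) v))))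
    (cong isLeft (trans (sym (vertex-comm (inj₁ nothing))) (cong (RootedMap.vertex (join N₁ N₂)) left-fixed)))
  side (inj₂ v) = trans (sym (join-path-side N₁ N₂ (Path-image φ left-fixed (join-path-right M₁ M₂ (RootedMap.rootVertex M₂) v))))
    (cong isLeft (trans (sym (vertex-comm (inj₂ nothing))) (cong (RootedMap.vertex (join N₁ N₂)) right-fixed)))

join-cancel : ∀ {a a′ b b′} {M₁ : RootedMap a} {M₂ : RootedMap b} {N₁ : RootedMap a′} {N₂ : RootedMap b′} →
              join M₁ M₂ ≅ join N₁ N₂ → M₁ ≅ N₁ × M₂ ≅ N₂
join-cancel {M₁ = M₁} {M₂} {N₁} {N₂} φ = left-iso , right-iso
  where
  open _≅_ φ
  module φ = JoinSides φ
  module φ⁻¹ = JoinSides (≅-sym φ)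
  module M₁ = RootedMap M₁
  module M₂ = RootedMap M₂
  module N₁ = RootedMap N₁
  module N₂ = RootedMap N₂
  αN = RootedMap.α (join N₁ N₂)
  module L = Subsystem {insert M₁.system M₁.root} {insert N₁.system N₁.root} (≅⇒≃ φ) ⊕-left ⊕-left
    (λ v → left _ (φ.side (inj₁ v))) (λ v → left _ (φ⁻¹.side (inj₁ v)))
  module L⁻ = InsertCancel {M₁.system} {N₁.system} {M₁.root} {N₁.root} L.restriction
    (inj₁-injective (trans (sym (L.to-onH nothing)) φ.left-fixed))
  to-left : ∀ h → to onH (inj₁ (just h)) ≡ inj₁ (just (to L⁻.onH⁻ h))
  to-left h = trans (L.to-onH (just h)) (cong inj₁ (L⁻.to-onH h))
  left-iso : M₁ ≅ N₁
  left-iso = ≃⇒≅ L⁻.cancel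
    (λ h → just-injective (inj₁-injective
      (trans (cong αN (sym (to-left h))) (trans (α-comm (inj₁ (just h))) (to-left (M₁.α h))))))
    L⁻.sameCorner
  module R = Subsystem {insert M₂.system M₂.root} {insert N₂.system N₂.root} (≅⇒≃ φ) ⊕-right ⊕-right
    (λ v → right _ (φ.side (inj₂ v))) (λ v → right _ (φ⁻¹.side (inj₂ v)))
  module R⁻ = InsertCancel {M₂.system} {N₂.system} {M₂.root} {N₂.root} R.restriction
    (inj₂-injective (trans (sym (R.to-onH nothing)) φ.right-fixed))
  to-right : ∀ h → to onH (inj₂ (just h)) ≡ inj₂ (just (to R⁻.onH⁻ h))
  to-right h = trans (R.to-onH (just h)) (cong inj₂ (R⁻.to-onH h))
  right-iso : M₂ ≅ N₂
  right-iso = ≃⇒≅ R⁻.cancel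
    (λ h → just-injective (inj₂-injective
      (trans (cong αN (sym (to-right h))) (trans (α-comm (inj₂ (just h))) (to-right (M₂.α h))))))
    R⁻.sameCorner

-- A path leaving an isolated vertex would begin with a half-edge there. This excludes `isolated`
-- corners in every map that has a half-edge.
isolated-unique : ∀ {n} (M : RootedMap n) (let module M = RootedMap M) v → (∀ h → M.vertex h ≢ v) → ∀ w → w ≡ v
isolated-unique M v i w with RootedMap.connected M v w
... | ε = refl
... | (h , p , _) ◅ _ = contradiction p (i h)

-- An automorphism fixes the root half-edge, and this propagates along σ and α.
automorphism-trivial : ∀ {n} (M : RootedMap n) (φ : M ≅ M) h → to (_≅_.onH φ) h ≡ h
automorphism-trivial M φ h = from-root (RootedMap.root M) root-comm
  where
  module M = RootedMap M
  open _≅_ φ using (onH; σ-comm; α-comm; root-comm)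
  Fixed : M.H → Set
  Fixed x = to onH x ≡ x
  around : ∀ {x y} → Star (λ x y → M.σ x ≡ y) x y → Fixed x → Fixed y
  around ε p = p
  around (refl ◅ s) p = around s (trans (sym (σ-comm _)) (cong M.σ p))
  along : ∀ {u v} → Star M.Adjacent u v → (∀ x → M.vertex x ≡ u → Fixed x) → ∀ x → M.vertex x ≡ v → Fixed x
  along ε p = p
  along ((y , q , refl) ◅ s) p = along s λ x e →
    around (M.cyclic (M.α y) x (sym e)) (trans (sym (α-comm y)) (cong M.α (p y q)))
  from-root : ∀ c → SameCorner≃ (≅⇒≃ φ) c c → Fixed h
  from-root (before r) (before p) =
    along (M.connected (M.vertex r) (M.vertex h)) (λ x e → around (M.cyclic r x (sym e)) p) h refl
  from-root (isolated v i) _ = contradiction (isolated-unique M v i (M.vertex h)) (i h)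

edgeless⇒no-half-edge : (M : RootedMap 0) → ¬ RootedMap.H M
edgeless⇒no-half-edge M h with () ← subst Fin (RootedMap.edges M) (to (RootedMap.finiteH M) h)

-- `RootIsthmicParts` accepts any decomposition of the map. Cancellation makes two decompositions of
-- the same kind isomorphic, and `join≇addEdge` rules out different kinds. Hence all choices of
-- representatives give `c` the same law.
parts-unique : ∀ {m n k l} {M : RootedMap m} {N : RootedMap n} → M ≅ N →
               RootIsthmicParts M k → RootIsthmicParts N l → k ≡ l
parts-unique φ (edgeless _) (edgeless _) = refl
parts-unique φ (edgeless M) (isthmic N₁ N₂ ψ _) =
  ⊥-elim (edgeless⇒no-half-edge M (from (_≅_.onH (≅-trans φ ψ)) (inj₁ nothing)))
parts-unique φ (edgeless M) (nonIsthmic N₀ c ψ _) =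
  ⊥-elim (edgeless⇒no-half-edge M (from (_≅_.onH (≅-trans φ ψ)) nothing))
parts-unique φ (isthmic M₁ M₂ θ _) (edgeless N) =
  ⊥-elim (edgeless⇒no-half-edge N (from (_≅_.onH (≅-trans (≅-sym φ) θ)) (inj₁ nothing)))
parts-unique φ (nonIsthmic M₀ c θ _) (edgeless N) =
  ⊥-elim (edgeless⇒no-half-edge N (from (_≅_.onH (≅-trans (≅-sym φ) θ)) nothing))
parts-unique φ (isthmic M₁ M₂ θ p) (isthmic N₁ N₂ ψ q) =
  cong suc (parts-unique (proj₁ (join-cancel (≅-trans (≅-sym θ) (≅-trans φ ψ)))) p q)
parts-unique φ (nonIsthmic M₀ c θ p) (nonIsthmic N₀ d ψ q) =
  parts-unique (proj₁ (addEdge-cancel (≅-trans (≅-sym θ) (≅-trans φ ψ)))) p q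
parts-unique φ (isthmic M₁ M₂ θ _) (nonIsthmic N₀ d ψ _) =
  ⊥-elim (join≇addEdge M₁ M₂ N₀ d (≅-trans (≅-sym ψ) (≅-trans (≅-sym φ) θ)))
parts-unique φ (nonIsthmic M₀ c θ _) (isthmic N₁ N₂ ψ _) =
  ⊥-elim (join≇addEdge N₁ N₂ M₀ c (≅-trans (≅-sym θ) (≅-trans φ ψ)))

-- Deleting a half-edge

Σ-≡ : ∀ {A : Set} {P : A → Set} → Irrelevant P → ∀ {a b} {p : P a} {q : P b} → a ≡ b → (a , p) ≡ (b , q)
Σ-≡ irr {p = p} {q} refl = cong (_ ,_) (irr p q)

-- Turns the `length (filter ...)` of `law-of-c` into a bijection with `Fin`, so that counts can be
-- compared through `↔⇒≡`.
filter-↔ : ∀ {A : Set} {P : A → Set} (P? : Decidable P) → Irrelevant P → ∀ {n} (f : Fin n → A) →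
           Σ (Fin n) (P ∘ f) ↔ Fin (length (filter P? (tabulate f)))
filter-↔ P? irr {zero} f = mk↔ₛ′ (λ ()) (λ ()) (λ ()) (λ ())
filter-↔ {P = P} P? irr {suc n} f with P? (f zero) | filter-↔ P? irr (f ∘ suc)
... | yes p | e = mk↔ₛ′ to′ from′
    (λ { zero → refl ; (suc i) → cong suc (strictlyInverseˡ e i) })
    (λ { (zero , q) → cong (zero ,_) (irr p q)
       ; (suc i , q) → cong (λ { (i , q) → suc i , q }) (strictlyInverseʳ e (i , q)) })
  where
  to′ : Σ (Fin (suc n)) (P ∘ f) → Fin (suc _)
  to′ (zero , _)  = zero
  to′ (suc i , q) = suc (to e (i , q))
  from′ : Fin (suc _) → Σ (Fin (suc n)) (P ∘ f)
  from′ zero    = zero , p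
  from′ (suc i) = let j , q = from e i in suc j , q
... | no ¬p | e = mk↔ₛ′
    (λ { (zero , q) → contradiction q ¬p ; (suc i , q) → to e (i , q) })
    (λ i → let j , q = from e i in suc j , q)
    (strictlyInverseˡ e)
    (λ { (zero , q) → contradiction q ¬p
       ; (suc i , q) → cong (λ { (i , q) → suc i , q }) (strictlyInverseʳ e (i , q)) })

Σ-↔ : ∀ {A B : Set} {P : A → Set} {Q : B → Set} → Irrelevant P → Irrelevant Q → (e : A ↔ B) →
      (∀ {a} → P a → Q (to e a)) → (∀ {b} → Q b → P (from e b)) → Σ A P ↔ Σ B Q
Σ-↔ irrP irrQ e f g = mk↔ₛ′ (λ { (a , p) → to e a , f p }) (λ { (b , q) → from e b , g q })
  (λ _ → Σ-≡ irrQ (strictlyInverseˡ e _)) (λ _ → Σ-≡ irrP (strictlyInverseʳ e _))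

subset-finite : ∀ {A : Set} {P : A → Set} {n} → Decidable P → Irrelevant P → A ↔ Fin n → ∃ λ m → Σ A P ↔ Fin m
subset-finite {P = P} P? irr e = _ , ↔-trans
  (Σ-↔ {Q = P ∘ from e} irr irr e (λ {a} → subst P (sym (strictlyInverseʳ e a))) id)
  (filter-↔ P? irr (from e))

-- Among the n+1 values consisting of y and all f i two coincide; as f is injective, y is one of
-- them.
injective⇒surjective : ∀ {n} (f : Fin n → Fin n) → Injective _≡_ _≡_ f → ∀ y → ∃ λ x → f x ≡ y
injective⇒surjective {n} f inj y with pigeonhole (ℕ.n<1+n n) (λ { zero → y ; (suc i) → f i })
... | zero  , suc j , _   , p = j , sym p
... | suc i , suc j , i<j , p = contradiction (cong suc (inj p)) (Fin.<⇒≢ i<j)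

-- The right inverse g is injective, hence onto by finiteness; so f is also a left inverse up to
-- rewriting arguments as values of g.
section⇒injective : ∀ {A : Set} {n} → A ↔ Fin n → (f g : A → A) → (∀ x → f (g x) ≡ x) → Injective _≡_ _≡_ f
section⇒injective e f g f∘g {x} {y} p with preimage x | preimage y
  where
  preimage : ∀ x → ∃ λ z → g z ≡ x
  preimage x =
    let i , q = injective⇒surjective (to e ∘ g ∘ from e)
          (λ {i} {j} q → to-injective (↔-sym e)
            (trans (sym (f∘g _)) (trans (cong f (to-injective e q)) (f∘g _)))) (to e x)
    in from e i , to-injective e q
... | z , refl | w , refl = cong g (trans (sym (f∘g z)) (trans p (f∘g w)))

-- The path that `cyclic` gives from σ h back to h ends with a step into h, or is empty, in which
-- case h is its own predecessor. So σ is onto, with a chosen section.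
σ-injective : ∀ S → Injective _≡_ _≡_ (σ S)
σ-injective S = section⇒injective (finiteH S) (σ S) (proj₁ ∘ predecessor) (proj₂ ∘ predecessor)
  where
  last : ∀ {x y} → ∃ (λ w → σ S w ≡ x) → Star (λ x y → σ S x ≡ y) x y → ∃ λ w → σ S w ≡ y
  last w ε        = w
  last _ (p ◅ ps) = last (_ , p) ps
  predecessor : ∀ h → ∃ λ w → σ S w ≡ h
  predecessor h = last (h , refl) (cyclic S (σ S h) h (σ-vertex S h))

Maybe-Fin : ∀ {n} → Maybe (Fin n) ↔ Fin (suc n)
Maybe-Fin = mk↔ₛ′ (λ { nothing → zero ; (just i) → suc i }) (λ { zero → nothing ; (suc i) → just i })
  (λ { zero → refl ; (suc _) → refl }) (λ { nothing → refl ; (just _) → refl })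

-- Puts `a` in the place `nothing`, so that what remains after its deletion is a `Fin m`.
pointed : ∀ {A : Set} {n} → A ↔ Fin n → (a : A) → ∃ λ m → Σ (Maybe (Fin m) ↔ A) λ ψ → to ψ nothing ≡ a
pointed {n = zero} e a with () ← to e a
pointed {n = suc n} e a =
  n , ↔-trans Maybe-Fin (↔-trans (transpose zero (to e a)) (↔-sym e)) , strictlyInverseʳ e a

redirect-≡ : ∀ S {x y : H S} {d : Dec (x ≡ y)} → x ≡ y → redirect S d ≡ nothing
redirect-≡ S {d = yes _} _ = refl
redirect-≡ S {d = no ¬p} p = contradiction p ¬p

redirect-≢ : ∀ S {x y : H S} {d : Dec (x ≡ y)} → x ≢ y → redirect S d ≡ just x
redirect-≢ S {d = yes p} ¬p = contradiction p ¬p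
redirect-≢ S {d = no _}  _  = refl

record Excision (S : RotationSystem) (h : H S) : Set₁ where
  field
    system : RotationSystem
    corner : Corner system
    iso    : insert system corner ≃ S
    fixed  : to (_≃_.onH iso) nothing ≡ h

  inclusion : H system → H S
  inclusion k = to (_≃_.onH iso) (just k)

  inclusion-injective : Injective _≡_ _≡_ inclusion
  inclusion-injective p = just-injective (to-injective (_≃_.onH iso) p)

  inclusion≢ : ∀ k → inclusion k ≢ h
  inclusion≢ k p with () ← to-injective (_≃_.onH iso) (trans p (sym fixed))

  preimage : ∀ x → x ≢ h → ∃ λ k → x ≡ inclusion k
  preimage x x≢h with from (_≃_.onH iso) x in eq
  ... | just k  = k , trans (sym (strictlyInverseˡ (_≃_.onH iso) x)) (cong (to (_≃_.onH iso)) eq)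
  ... | nothing = contradiction
    (trans (sym (strictlyInverseˡ (_≃_.onH iso) x)) (trans (cong (to (_≃_.onH iso)) eq) fixed)) x≢h

-- Here `s` is σ carried over to `Maybe K`, with `nothing` for the deleted half-edge. The new
-- successor follows `s` and jumps over `nothing`; the corner that is left lies before `s nothing`,
-- or is isolated if `nothing` was alone at its vertex.
excise-at : ∀ S h {n} (ψ : Maybe (Fin n) ↔ H S) → to ψ nothing ≡ h → Excision S h
excise-at S h {n} ψ ψ-nothing = record
  { system = S⁻ ; corner = corner (s nothing) refl ; iso = iso ; fixed = ψ-nothing }
  where
  K = Fin n

  s : Maybe K → Maybe K
  s x = from ψ (σ S (to ψ x))

  w : Maybe K → V S
  w x = vertex S (to ψ x)

  to-s : ∀ x → to ψ (s x) ≡ σ S (to ψ x)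
  to-s x = strictlyInverseˡ ψ _

  w-s : ∀ x → w (s x) ≡ w x
  w-s x = trans (cong (vertex S) (to-s x)) (σ-vertex S (to ψ x))

  s-injective : Injective _≡_ _≡_ s
  s-injective p = to-injective ψ (σ-injective S (to-injective (↔-sym ψ) p))

  _↝_ : Maybe K → Maybe K → Set
  _↝_ = Star (λ x y → s x ≡ y)

  s-cyclic : ∀ x y → w x ≡ w y → x ↝ y
  s-cyclic x y p = subst (λ x → x ↝ y) (strictlyInverseʳ ψ x) (subst (from ψ (to ψ x) ↝_) (strictlyInverseʳ ψ y)
    (gmap (from ψ) (λ { {a} refl → cong (from ψ ∘ σ S) (strictlyInverseˡ ψ a) }) (cyclic S (to ψ x) (to ψ y) p)))

  stuck : s nothing ≡ nothing → ∀ {k} → ¬ (nothing ↝ just k)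
  stuck p (q ◅ r) with refl ← trans (sym p) q = stuck p r

  skip : Maybe K → Maybe K → K → K
  skip (just k) _        _ = k
  skip nothing  (just k) _ = k
  -- A default that never matters for `s`: by injectivity `nothing` cannot be the successor both of
  -- `just k` and of itself.
  skip nothing  nothing  k = k

  σ⁻ : K → K
  σ⁻ k = skip (s (just k)) (s nothing) k

  σ⁻-vertex : ∀ k → w (just (σ⁻ k)) ≡ w (just k)
  σ⁻-vertex k with s (just k) in p | s nothing in q
  ... | just _  | _      = trans (cong w (sym p)) (w-s (just k))
  ... | nothing | just _ = trans (cong w (sym q)) (trans (w-s nothing) (trans (cong w (sym p)) (w-s (just k))))
  ... | nothing | nothing = refl

  σ⁻-star : ∀ {x y} → just x ↝ just y → Star (λ x y → σ⁻ x ≡ y) x y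
  σ⁻-star ε = ε
  σ⁻-star {x} (_◅_ {j = just k} p r) = cong (λ m → skip m (s nothing) x) p ◅ σ⁻-star r
  σ⁻-star {x} (_◅_ {j = nothing} p (_◅_ {j = just k} q r)) = cong₂ (λ m m′ → skip m m′ x) p q ◅ σ⁻-star r
  σ⁻-star (_◅_ {j = nothing} p (_◅_ {j = nothing} q r)) = ⊥-elim (stuck q r)

  S⁻ : RotationSystem
  S⁻ = record
    { V = V S ; H = K ; #V = _ ; #H = n ; finiteV = finiteV S ; finiteH = ↔-refl
    ; vertex = w ∘ just ; σ = σ⁻ ; σ-vertex = σ⁻-vertex
    ; cyclic = λ x y p → σ⁻-star (s-cyclic (just x) (just y) p) }

  corner : ∀ m → s nothing ≡ m → Corner S⁻
  corner (just k) _ = before k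
  corner nothing  p = isolated (w nothing) λ k q → stuck p (s-cyclic nothing (just k) (sym q))

  corner-vertex : ∀ m p → cornerVertex S⁻ (corner m p) ≡ w nothing
  corner-vertex (just k) p = trans (cong w (sym p)) (w-s nothing)
  corner-vertex nothing  p = refl

  corner-σ : ∀ m p x → s x ≡ σ⁺ S⁻ (corner m p) x
  corner-σ (just k) p nothing = p
  corner-σ (just k) p (just x) = by-cases (s (just x)) refl
    where
    by-cases : ∀ m → s (just x) ≡ m → s (just x) ≡ σ⁺ S⁻ (before k) (just x)
    by-cases nothing  q = trans q (sym (redirect-≡ S⁻ (cong₂ (λ m m′ → skip m m′ x) q p)))
    -- Here y differs from k, because `just k` is already the successor of `nothing` and `s` is
    -- injective; so σ⁺ does not redirect.
    by-cases (just y) q = trans q (trans (cong just (sym σ⁻≡y)) (sym (redirect-≢ S⁻ λ r →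
      contradiction (s-injective (trans q (trans (cong just (trans (sym σ⁻≡y) r)) (sym p)))) λ ())))
      where
      σ⁻≡y : σ⁻ x ≡ y
      σ⁻≡y = cong (λ m → skip m (s nothing) x) q
  corner-σ nothing p nothing = p
  corner-σ nothing p (just x) with s (just x) in q
  ... | just y  = refl
  ... | nothing with () ← s-injective (trans p (sym q))

  iso : insert S⁻ (corner (s nothing) refl) ≃ S
  iso = record
    { onV = ↔-refl ; onH = ψ
    ; vertex-comm = λ { nothing → sym (corner-vertex _ refl) ; (just _) → refl }
    ; σ-comm = λ x → trans (sym (to-s x)) (cong (to ψ) (corner-σ _ refl x)) }

abstract
  excise : ∀ S h → Excision S h
  excise S h = let _ , ψ , ψ-nothing = pointed (finiteH S) h in excise-at S h ψ ψ-nothing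

-- In each pair {x, α x} exactly one element precedes its partner in the enumeration, so `A` is two
-- copies of the set of these `Lower` elements.
paired⇒even : ∀ {A : Set} {n} → A ↔ Fin n → (α : A → A) → (∀ x → α (α x) ≡ x) → (∀ x → α x ≢ x) → ∃ λ m → n ≡ m * 2
paired⇒even {A} {n} e α α-involutive α-fixfree =
  m , trans (sym (↔⇒≡ (↔-trans (↔-trans +↔⊎ (↔-sym lower-finite ⊎-↔ ↔-sym lower-finite)) (↔-trans halves e))))
            (trans (cong (m +_) (sym (ℕ.+-identityʳ m))) (ℕ.*-comm 2 m))
  where
  Lower : A → Set
  Lower x = to e x Fin.< to e (α x)
  finite = subset-finite {P = Lower} (λ x → to e x Fin.<? to e (α x)) ℕ.<-irrelevant e
  m = proj₁ finite
  lower-finite = proj₂ finite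
  upper : ∀ {x} → to e (α x) Fin.< to e x → Lower (α x)
  upper {x} = subst (λ y → to e (α x) Fin.< to e y) (sym (α-involutive x))
  sort : ∀ x → Tri (to e x Fin.< to e (α x)) (to e x ≡ to e (α x)) (to e (α x) Fin.< to e x) → Σ A Lower ⊎ Σ A Lower
  sort x (tri< p _ _) = inj₁ (x , p)
  sort x (tri≈ _ p _) = contradiction (sym (to-injective e p)) (α-fixfree x)
  sort x (tri> _ _ p) = inj₂ (α x , upper p)
  unsort : Σ A Lower ⊎ Σ A Lower → A
  unsort (inj₁ (x , _)) = x
  unsort (inj₂ (x , _)) = α x
  unsort-sort : ∀ x t → unsort (sort x t) ≡ x
  unsort-sort x (tri< _ _ _) = refl
  unsort-sort x (tri≈ _ p _) = contradiction (sym (to-injective e p)) (α-fixfree x)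
  unsort-sort x (tri> _ _ _) = α-involutive x
  sort-unsort : ∀ y t → sort (unsort y) t ≡ y
  sort-unsort (inj₁ (x , p)) (tri< _ _ _)  = cong inj₁ (Σ-≡ ℕ.<-irrelevant refl)
  sort-unsort (inj₁ (x , p)) (tri≈ ¬p _ _) = contradiction p ¬p
  sort-unsort (inj₁ (x , p)) (tri> ¬p _ _) = contradiction p ¬p
  sort-unsort (inj₂ (x , p)) (tri< _ _ ¬p) = contradiction (upper-of p) ¬p
    where
    upper-of : Lower x → to e (α (α x)) Fin.< to e (α x)
    upper-of = subst (λ y → to e y Fin.< to e (α x)) (sym (α-involutive x))
  sort-unsort (inj₂ (x , p)) (tri≈ _ q _)  = contradiction (sym (to-injective e q)) (α-fixfree (α x))
  sort-unsort (inj₂ (x , p)) (tri> _ _ _)  = cong inj₂ (Σ-≡ ℕ.<-irrelevant (α-involutive x))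
  halves : (Σ A Lower ⊎ Σ A Lower) ↔ A
  halves = mk↔ₛ′ unsort (λ x → sort x (<-cmp _ _)) (λ x → unsort-sort x (<-cmp _ _)) (λ y → sort-unsort y (<-cmp _ _))

-- Adding an arrow s → t enlarges what is reachable from u, if this contains s, by what is reachable from t.
reachable : ∀ {A : Set} → DecidableEquality A → ∀ {n} (s t : Fin n → A) {P : Fin n → Set} → Decidable P →
  (let _⟶_ = λ x y → ∃ λ i → P i × s i ≡ x × t i ≡ y) → ∀ u →
  ∃ λ (r : A → Bool) → r u ≡ true × (∀ {x y} → x ⟶ y → r x ≡ true → r y ≡ true) ×
                       (∀ v → r v ≡ true → Star _⟶_ u v)
reachable _≟_ {zero} s t P? u = (λ v → does (v ≟ u)) , reflexive , (λ ()) , arrive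
  where
  reflexive : does (u ≟ u) ≡ true
  reflexive with u ≟ u
  ... | yes _ = refl
  ... | no ¬p = contradiction refl ¬p
  arrive : ∀ {T : _ → _ → Set} v → does (v ≟ u) ≡ true → Star T u v
  arrive v p with yes refl ← v ≟ u = ε
reachable {A} _≟_ {suc n} s t {P} P? u
  with reachable _≟_ (s ∘ suc) (t ∘ suc) (P? ∘ suc) u | reachable _≟_ (s ∘ suc) (t ∘ suc) (P? ∘ suc) (t zero) | P? zero
... | r , ru , closed , arrive | r′ , rt , closed′ , arrive′ | d = extend d (r (s zero)) refl
  where
  _⟶_ : A → A → Set
  x ⟶ y = ∃ λ i → P i × s i ≡ x × t i ≡ y
  shift : ∀ {x y} → Star (λ x y → ∃ λ i → P (suc i) × s (suc i) ≡ x × t (suc i) ≡ y) x y → Star _⟶_ x y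
  shift = gmap id λ { (i , p) → suc i , p }
  extend : Dec (P zero) → ∀ b → r (s zero) ≡ b → ∃ λ (r : A → Bool) → r u ≡ true ×
    (∀ {x y} → x ⟶ y → r x ≡ true → r y ≡ true) × (∀ v → r v ≡ true → Star _⟶_ u v)
  extend (no ¬p) _ _ = r , ru
    , (λ { (zero , p , _) _ → contradiction p ¬p ; (suc i , p) q → closed (i , p) q }) , λ v q → shift (arrive v q)
  extend (yes p) false e = r , ru
    , (λ { (zero , _ , refl , _) q → contradiction (trans (sym e) q) λ () ; (suc i , p) q → closed (i , p) q })
    , λ v q → shift (arrive v q)
  extend (yes p) true e = (λ v → r v ∨ r′ v) , cong (_∨ r′ u) ru , closed⁺ , arrive⁺
    where
    closed⁺ : ∀ {x y} → x ⟶ y → r x ∨ r′ x ≡ true → r y ∨ r′ y ≡ true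
    closed⁺ (zero , _ , _ , refl) _ = trans (cong (r (t zero) ∨_) rt) (Bool.∨-zeroʳ (r (t zero)))
    closed⁺ {x} {y} (suc i , p) q with r x in rx
    ... | true  = cong (_∨ r′ y) (closed (i , p) rx)
    ... | false = trans (cong (r y ∨_) (closed′ (i , p) q)) (Bool.∨-zeroʳ (r y))
    arrive⁺ : ∀ v → r v ∨ r′ v ≡ true → Star _⟶_ u v
    arrive⁺ v q with r v in rv
    ... | true  = shift (arrive v rv)
    ... | false = shift (arrive (s zero) e) ◅◅ (zero , p , refl , refl) ◅ shift (arrive′ v q)

fibre-irrelevant : ∀ {A : Set} {f : A → Bool} {b} → Irrelevant (λ a → f a ≡ b)
fibre-irrelevant = Decidable⇒UIP.≡-irrelevant Bool._≟_

fibre-split : ∀ {A : Set} (f : A → Bool) → (Σ A (λ a → f a ≡ true) ⊎ Σ A (λ a → f a ≡ false)) ↔ A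
fibre-split {A} f = mk↔ₛ′ merge (λ a → place a (f a) refl) (λ a → merge-place a (f a) refl) place-merge
  where
  merge : Σ A (λ a → f a ≡ true) ⊎ Σ A (λ a → f a ≡ false) → A
  merge = Sum.[ proj₁ , proj₁ ]′
  place : ∀ a b → f a ≡ b → Σ A (λ a → f a ≡ true) ⊎ Σ A (λ a → f a ≡ false)
  place a true  p = inj₁ (a , p)
  place a false p = inj₂ (a , p)
  merge-place : ∀ a b p → merge (place a b p) ≡ a
  merge-place a true  p = refl
  merge-place a false p = refl
  place-≡ : ∀ a b p → place a (f a) refl ≡ place a b p
  place-≡ a _ refl = refl
  place-merge : ∀ x → place (merge x) (f (merge x)) refl ≡ x
  place-merge (inj₁ (a , p)) = place-≡ a true p
  place-merge (inj₂ (a , p)) = place-≡ a false p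

module Halves (S : RotationSystem) (side : V S → Bool) where

  half : Bool → RotationSystem
  half b = record
    { V = Σ (V S) λ v → side v ≡ b ; H = Σ (H S) λ h → side (vertex S h) ≡ b
    ; #V = _ ; #H = _
    ; finiteV = proj₂ (subset-finite (λ v → side v Bool.≟ b) (fibre-irrelevant {f = side}) (finiteV S))
    ; finiteH = proj₂ (subset-finite (λ h → side (vertex S h) Bool.≟ b) (fibre-irrelevant {f = side ∘ vertex S}) (finiteH S))
    ; vertex = λ { (h , p) → vertex S h , p }
    ; σ = σ-half
    ; σ-vertex = λ { (h , p) → Σ-≡ (fibre-irrelevant {f = side}) (σ-vertex S h) }
    ; cyclic = λ { (h , p) (h′ , p′) e → lift p p′ (cyclic S h h′ (cong proj₁ e)) } }
    where
    σ-half : Σ (H S) (λ h → side (vertex S h) ≡ b) → Σ (H S) λ h → side (vertex S h) ≡ b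
    σ-half (h , p) = σ S h , trans (cong side (σ-vertex S h)) p
    lift : ∀ {x y} p q → Star (λ x y → σ S x ≡ y) x y → Star (λ x y → σ-half x ≡ y) (x , p) (y , q)
    lift p q ε          = subst (λ r → Star _ (_ , p) (_ , r)) (fibre-irrelevant {f = side ∘ vertex S} p q) ε
    lift p q (refl ◅ s) = refl ◅ lift _ q s

  halves : half true ⊕ half false ≃ S
  halves = record
    { onV = fibre-split side ; onH = fibre-split (side ∘ vertex S)
    ; vertex-comm = λ { (inj₁ _) → refl ; (inj₂ _) → refl }
    ; σ-comm = λ { (inj₁ _) → refl ; (inj₂ _) → refl } }

-- The decomposition of rooted maps

module _ {n} (M : RootedMap n) (r : RootedMap.H M) where
  private module M = RootedMap M
  open Deletion M r

  -- Shared by both cases of the decomposition: α and the paths of `M` are pulled back along ι and ν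
  -- to what is left after excision, which works because its vertices are closed under `Linked`. The
  -- number of edges is merely shown to exist here; `≅⇒edges≡` identifies it later.
  module Submap
    (S : RotationSystem) (c : Corner S) (ν : V S → M.V) (ι : H S → M.H)
    (ν-injective : Injective _≡_ _≡_ ν) (ι-injective : Injective _≡_ _≡_ ι)
    (vertex-comm : ∀ k → M.vertex (ι k) ≡ ν (vertex S k))
    (ι-kept : ∀ k → Kept (ι k))
    (ι-preimage : ∀ h → Kept h → ∃ (λ v → M.vertex h ≡ ν v) → ∃ λ k → h ≡ ι k)
    (closed : ∀ {u w} → Linked (ν u) w → ∃ λ v → w ≡ ν v)
    (connected : ∀ u v → Path (ν u) (ν v)) where

    partner : ∀ k → ∃ λ k′ → M.α (ι k) ≡ ι k′
    partner k = ι-preimage (M.α (ι k)) (proj₁ (proj₂ (Linked-sym link))) (closed link)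
      where
      link : Linked (ν (vertex S k)) (M.vertex (M.α (ι k)))
      link = ι k , ι-kept k , vertex-comm k , refl

    α : H S → H S
    α = proj₁ ∘ partner

    ι-α : ∀ k → M.α (ι k) ≡ ι (α k)
    ι-α = proj₂ ∘ partner

    α-involutive : ∀ k → α (α k) ≡ k
    α-involutive k = ι-injective (trans (sym (ι-α _)) (trans (cong M.α (sym (ι-α k))) (M.α-involutive _)))

    α-fixfree : ∀ k → α k ≢ k
    α-fixfree k p = M.α-fixfree (ι k) (trans (ι-α k) (cong ι p))

    size : ∃ λ m → RotationSystem.#H S ≡ m * 2
    size = paired⇒even (finiteH S) α α-involutive α-fixfree

    lift : ∀ {a b u v} → Path a b → a ≡ ν u → b ≡ ν v → Star (λ u v → ∃ λ k → vertex S k ≡ u × vertex S (α k) ≡ v) u v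
    lift ε p q = subst (Star _ _) (ν-injective (trans (sym p) q)) ε
    lift (l@(h , kept , hu , hw) ◅ s) refl q
      with k , refl ← ι-preimage h kept (_ , hu) | w , refl ← closed l =
      (k , ν-injective (trans (sym (vertex-comm k)) hu)
         , ν-injective (trans (sym (vertex-comm (α k))) (trans (cong M.vertex (sym (ι-α k))) hw)))
      ◅ lift s refl q

    submap : RootedMap (proj₁ size)
    submap = record
      { system = S ; α = α ; α-involutive = α-involutive ; α-fixfree = α-fixfree ; edges = proj₂ size
      ; connected = λ u v → lift (connected u v) refl refl ; root = c }

  module _ (root-r : M.root ≡ before r) where

    module NonIsthmic (connected : ∀ u v → Path u v) where
      -- `addEdge` inserts the root half-edge first and its partner last, so the partner is removed
      -- first.
      E₁ = excise M.system (M.α r)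
      module E₁ = Excision E₁
      module iso₁ = _≃_ E₁.iso
      leg = E₁.preimage r (λ p → M.α-fixfree r (sym p))
      E₂ = excise E₁.system (proj₁ leg)
      module E₂ = Excision E₂
      module iso₂ = _≃_ E₂.iso

      ν : V E₂.system → M.V
      ν = to iso₁.onV ∘ to iso₂.onV
      ι : H E₂.system → M.H
      ι = E₁.inclusion ∘ E₂.inclusion

      ν-surjective : ∀ w → ∃ λ v → w ≡ ν v
      ν-surjective w = from iso₂.onV (from iso₁.onV w) ,
        sym (trans (cong (to iso₁.onV) (strictlyInverseˡ iso₂.onV _)) (strictlyInverseˡ iso₁.onV w))

      preimage : ∀ h → Kept h → ∃ λ k → h ≡ ι k
      preimage h (h≢r , h≢αr) with k , refl ← E₁.preimage h h≢αr
        with l , refl ← E₂.preimage k (λ { refl → h≢r (sym (proj₂ leg)) }) = l , refl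

      module Sub = Submap E₂.system E₂.corner ν ι
        (λ p → to-injective iso₂.onV (to-injective iso₁.onV p))
        (λ p → E₂.inclusion-injective (E₁.inclusion-injective p))
        (λ k → trans (iso₁.vertex-comm (just (E₂.inclusion k))) (cong (to iso₁.onV) (iso₂.vertex-comm (just k))))
        (λ k → (λ p → E₂.inclusion≢ k (E₁.inclusion-injective (trans p (proj₂ leg)))) , E₁.inclusion≢ _)
        (λ h kept _ → preimage h kept)
        (λ _ → ν-surjective _)
        (λ u v → connected _ _)
      M₀ = Sub.submap

      -- The place of `α r` is a corner of `E₁.system`; `addEdge` needs it in the isomorphic system
      -- obtained by reinserting `r`.
      corner = image (≃-sym E₂.iso) E₁.corner
      c = proj₁ corner

      φ : insert (insert E₂.system E₂.corner) c ≃ M.system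
      φ = ≃-trans (insert-cong E₂.iso (SameCorner-sym (≃-sym E₂.iso) (proj₂ corner))) E₁.iso

      leg-image : to (_≃_.onH φ) (just nothing) ≡ r
      leg-image = trans (cong E₁.inclusion E₂.fixed) (sym (proj₂ leg))

      nonIsthmic-≅ : M ≅ addEdge M₀ c
      nonIsthmic-≅ = ≅-sym (≃⇒≅ φ
        (λ { nothing → trans (cong M.α E₁.fixed) (trans (M.α-involutive r) (sym leg-image))
           ; (just nothing) → trans (cong M.α leg-image) (sym E₁.fixed)
           ; (just (just k)) → Sub.ι-α k })
        (subst (SameCorner≃ φ (before (just nothing))) (sym root-r) (before leg-image)))

    module Isthmic (side : M.V → Bool) (closed : ∀ {u v} → Linked u v → side u ≡ true → side v ≡ true)
                   (arrive : ∀ v → side v ≡ true → Path (M.vertex r) v)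
                   (r-side : side (M.vertex r) ≡ true) (αr-side : side (M.vertex (M.α r)) ≡ false) where
      open Halves M.system side

      closed′ : ∀ b {u v} → Linked u v → side u ≡ b → side v ≡ b
      closed′ true      l p = closed l p
      closed′ false {v = v} l p with side v in q
      ... | false = refl
      ... | true  = trans (sym (closed (Linked-sym l) q)) p

      Path-sym : ∀ {u v} → Path u v → Path v u
      Path-sym = reverse Linked-sym

      -- Follow a walk to the root vertex up to its first use of the root edge: at that moment it
      -- stands at one end of this edge. Hence the vertices off `side` form the single class of the
      -- vertex of `α r`.
      ends : ∀ {v} → Star M.Adjacent v (M.vertex r) → Path v (M.vertex r) ⊎ Path v (M.vertex (M.α r))
      ends ε = inj₁ ε
      ends ((h , refl , refl) ◅ s) with RotationSystem._≟ᴴ_ M.system h r | RotationSystem._≟ᴴ_ M.system h (M.α r)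
      ... | yes refl | _        = inj₁ ε
      ... | no _     | yes refl = inj₂ ε
      ... | no p     | no q     = Sum.map (link ◅_) (link ◅_) (ends s)
        where link = h , (p , q) , refl , refl

      path-closed : ∀ {u v} → Path u v → side u ≡ true → side v ≡ true
      path-closed ε       p = p
      path-closed (l ◅ s) p = path-closed s (closed l p)

      to-αr : ∀ v → side v ≡ false → Path v (M.vertex (M.α r))
      to-αr v p with ends (M.connected v (M.vertex r))
      ... | inj₂ s = s
      ... | inj₁ s = contradiction (trans (sym p) (path-closed (Path-sym s) r-side)) λ ()

      side-connected : ∀ b u v → side u ≡ b → side v ≡ b → Path u v
      side-connected true  u v p q = Path-sym (arrive u p) ◅◅ arrive v q
      side-connected false u v p q = to-αr u p ◅◅ Path-sym (to-αr v q)

      -- Both components at once: x is `r` for b = true and `α r` for b = false. `kept` and `kept⇒≢`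
      -- say that x is the only half-edge of the root edge in this half.
      module Component (b : Bool) (x : M.H) (x-side : side (M.vertex x) ≡ b)
                       (kept : ∀ h → side (M.vertex h) ≡ b → h ≢ x → Kept h) (kept⇒≢ : ∀ h → Kept h → h ≢ x) where
        E = excise (half b) (x , x-side)
        module E = Excision E
        module iso = _≃_ E.iso
        ν : V E.system → M.V
        ν v = proj₁ (to iso.onV v)
        ι : H E.system → M.H
        ι k = proj₁ (E.inclusion k)
        irr-V : Irrelevant (λ v → side v ≡ b)
        irr-V = fibre-irrelevant {f = side}
        irr-H : Irrelevant (λ h → side (M.vertex h) ≡ b)
        irr-H = fibre-irrelevant {f = side ∘ M.vertex}
        in-side : ∀ w → side w ≡ b → ∃ λ v → w ≡ ν v
        in-side w p = from iso.onV (w , p) , sym (cong proj₁ (strictlyInverseˡ iso.onV (w , p)))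
        preimage : ∀ h → Kept h → ∃ (λ v → M.vertex h ≡ ν v) → ∃ λ k → h ≡ ι k
        preimage h k (v , p) = let l , q = E.preimage (h , trans (cong side p) (proj₂ (to iso.onV v))) (λ e → kept⇒≢ h k (cong proj₁ e))
                               in l , cong proj₁ q
        module Sub = Submap E.system E.corner ν ι
          (λ p → to-injective iso.onV (Σ-≡ irr-V p))
          (λ p → E.inclusion-injective (Σ-≡ irr-H p))
          (λ k → cong proj₁ (iso.vertex-comm (just k)))
          (λ k → kept _ (proj₂ (E.inclusion k)) (λ p → E.inclusion≢ k (Σ-≡ irr-H p)))
          preimage
          (λ {u} l → in-side _ (closed′ b l (proj₂ (to iso.onV u))))
          (λ u v → side-connected b _ _ (proj₂ (to iso.onV u)) (proj₂ (to iso.onV v)))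
        component = Sub.submap

        ι-α : ∀ k → M.α (ι k) ≡ ι (RootedMap.α component k)
        ι-α = Sub.ι-α

      kept₁ : ∀ h → side (M.vertex h) ≡ true → h ≢ r → Kept h
      kept₁ h p h≢r = h≢r , λ { refl → contradiction (trans (sym p) αr-side) λ () }

      kept₂ : ∀ h → side (M.vertex h) ≡ false → h ≢ M.α r → Kept h
      kept₂ h p h≢αr = (λ { refl → contradiction (trans (sym p) r-side) λ () }) , h≢αr

      module C₁ = Component true r r-side kept₁ (λ _ → proj₁)
      module C₂ = Component false (M.α r) αr-side kept₂ (λ _ → proj₂)

      φ : insert C₁.E.system C₁.E.corner ⊕ insert C₂.E.system C₂.E.corner ≃ M.system
      φ = ≃-trans (⊕-cong C₁.E.iso C₂.E.iso) halves

      isthmic-≅ : M ≅ join C₁.component C₂.component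
      isthmic-≅ = ≅-sym (≃⇒≅ φ
        (λ { (inj₁ nothing) → trans (cong M.α (cong proj₁ C₁.E.fixed)) (sym (cong proj₁ C₂.E.fixed))
           ; (inj₂ nothing) → trans (cong M.α (cong proj₁ C₂.E.fixed)) (trans (M.α-involutive r) (sym (cong proj₁ C₁.E.fixed)))
           ; (inj₁ (just k)) → C₁.ι-α k
           ; (inj₂ (just k)) → C₂.ι-α k })
        (subst (SameCorner≃ φ (before (inj₁ nothing))) (sym root-r) (before (cong proj₁ C₁.E.fixed))))

data Decomposition {n} (M : RootedMap n) : Set₁ where
  isthmic    : ∀ {a b} (M₁ : RootedMap a) (M₂ : RootedMap b) → M ≅ join M₁ M₂ → Decomposition M
  nonIsthmic : ∀ {m} (M₀ : RootedMap m) c → M ≅ addEdge M₀ c → Decomposition M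

-- The computed set `side` of vertices reachable without the root edge serves twice: its value at
-- the other end of that edge selects the case, and in the isthmic case it separates the two
-- components.
decompose-at : ∀ {n} (M : RootedMap n) r → RootedMap.root M ≡ before r → Decomposition M
decompose-at M r root-r = by-cases (side (M.vertex (M.α r))) refl
  where
  module M = RootedMap M
  open Deletion M r
  e = M.finiteH
  reach = reachable (Fin.inj⇒≟ (↔⇒↣ M.finiteV)) (M.vertex ∘ from e) (M.vertex ∘ M.α ∘ from e)
    {P = Kept ∘ from e}
    (λ i → ¬? (RotationSystem._≟ᴴ_ M.system (from e i) r) ×-dec ¬? (RotationSystem._≟ᴴ_ M.system (from e i) (M.α r)))
    (M.vertex r)
  side = proj₁ reach
  closed : ∀ {u v} → Linked u v → side u ≡ true → side v ≡ true
  closed (h , kept , refl , refl) = proj₁ (proj₂ (proj₂ reach)) (to e h , subst Kept (sym (strictlyInverseʳ e h)) kept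
    , cong M.vertex (strictlyInverseʳ e h) , cong (M.vertex ∘ M.α) (strictlyInverseʳ e h))
  arrive : ∀ v → side v ≡ true → Path (M.vertex r) v
  arrive v p = gmap id (λ { (i , q) → from e i , q }) (proj₂ (proj₂ (proj₂ reach)) v p)

  -- If α r is still reachable from r without the root edge, so is everything else.
  all-connected : side (M.vertex (M.α r)) ≡ true → ∀ u v → Path u v
  all-connected p u v = bridge (M.connected u v)
    where
    detour : Path (M.vertex r) (M.vertex (M.α r))
    detour = arrive _ p
    bridge : ∀ {u v} → Star M.Adjacent u v → Path u v
    bridge ε = ε
    bridge ((h , refl , refl) ◅ s) with RotationSystem._≟ᴴ_ M.system h r | RotationSystem._≟ᴴ_ M.system h (M.α r)
    ... | yes refl | _        = detour ◅◅ bridge s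
    ... | no _     | yes refl = reverse Linked-sym detour ◅◅ subst (λ h → Path (M.vertex h) _) (M.α-involutive r) (bridge s)
    ... | no p     | no q     = (h , (p , q) , refl , refl) ◅ bridge s

  by-cases : ∀ b → side (M.vertex (M.α r)) ≡ b → Decomposition M
  by-cases true  p = nonIsthmic M₀ c nonIsthmic-≅
    where open NonIsthmic M r root-r (all-connected p)
  by-cases false p = isthmic C₁.component C₂.component isthmic-≅
    where open Isthmic M r root-r side closed arrive (proj₁ (proj₂ reach)) p

decompose : ∀ {n} (M : RootedMap (suc n)) → Decomposition M
decompose M = from-root (RootedMap.root M) refl
  where
  module M = RootedMap M
  h : M.H
  h = from M.finiteH (subst Fin (sym M.edges) zero)
  from-root : ∀ c → M.root ≡ c → Decomposition M
  from-root (before r)     p = decompose-at M r p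
  from-root (isolated v i) _ = contradiction (isolated-unique M v i (M.vertex h)) (i h)

-- Enumeration and recurrences

-- The Cauchy product Σ f i · g (n-i), peeled from the left to avoid subtraction.
conv : (ℕ → ℕ) → (ℕ → ℕ) → ℕ → ℕ
conv f g zero    = f 0 * g 0
conv f g (suc n) = f 0 * g (suc n) + conv (f ∘ suc) g n

Antidiagonal : (ℕ → Set) → (ℕ → Set) → ℕ → Set
Antidiagonal F G n = Σ ℕ λ a → Σ ℕ λ b → a + b ≡ n × F a × G b

Antidiagonal-↔ : ∀ {F G : ℕ → Set} {f g} → (∀ m → F m ↔ Fin (f m)) → (∀ m → G m ↔ Fin (g m)) →
                 ∀ n → Antidiagonal F G n ↔ Fin (conv f g n)
Antidiagonal-↔ {F} {G} e e′ zero = ↔-trans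
  (mk↔ₛ′ to′ (λ { (x , y) → 0 , 0 , refl , x , y }) (λ _ → refl) (λ { (zero , zero , refl , _) → refl }))
  (↔-trans (e 0 ×-↔ e′ 0) (↔-sym *↔×))
  where
  to′ : Antidiagonal F G 0 → F 0 × G 0
  to′ (zero , zero , refl , x , y) = x , y
Antidiagonal-↔ {F} {G} e e′ (suc n) = ↔-trans
  (mk↔ₛ′ to′ from′
    (λ { (inj₁ _) → refl ; (inj₂ (_ , _ , refl , _)) → refl })
    (λ { (zero , _ , refl , _) → refl ; (suc _ , _ , refl , _) → refl }))
  (↔-trans ((↔-trans (e 0 ×-↔ e′ (suc n)) (↔-sym *↔×)) ⊎-↔ Antidiagonal-↔ (e ∘ suc) e′ n) (↔-sym +↔⊎))
  where
  to′ : Antidiagonal F G (suc n) → F 0 × G (suc n) ⊎ Antidiagonal (F ∘ suc) G n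
  to′ (zero  , _ , refl , x , y) = inj₁ (x , y)
  to′ (suc a , b , refl , x , y) = inj₂ (a , b , refl , x , y)
  from′ : F 0 × G (suc n) ⊎ Antidiagonal (F ∘ suc) G n → Antidiagonal F G (suc n)
  from′ (inj₁ (x , y)) = 0 , suc n , refl , x , y
  from′ (inj₂ (a , b , p , x , y)) = suc a , b , cong suc p , x , y

-- Unlike in `UniformRootedMap`, the index set may be any finite type, so that sums and products of
-- index sets serve directly, and completeness is a separate property.
record Family (n : ℕ) : Set₁ where
  field
    Index       : Set
    size        : ℕ
    finite      : Index ↔ Fin size
    map         : Index → RootedMap n
    irredundant : ∀ i j → map i ≅ map j → i ≡ j
    c           : Index → ℕ
    c-correct   : ∀ i → RootIsthmicParts (map i) (c i)

  Complete : Set₁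
  Complete = ∀ (M : RootedMap n) → ∃ λ i → M ≅ map i

  Class : ℕ → Set
  Class k = Σ Index λ i → c i ≡ k

open Family using (Index; Complete; Class)

≅⇒edges≡ : ∀ {m n} {M : RootedMap m} {N : RootedMap n} → M ≅ N → m ≡ n
≅⇒edges≡ {m} {n} {M} {N} φ = ℕ.*-cancelʳ-≡ m n 2 (trans (sym (RootedMap.edges M)) (trans
  (↔⇒≡ (↔-trans (↔-sym (RootedMap.finiteH M)) (↔-trans (_≅_.onH φ) (RootedMap.finiteH N)))) (RootedMap.edges N)))

dot-unique : (M : RootedMap 0) → M ≅ dot
dot-unique M = ≃⇒≅ φ (λ h → ⊥-elim (edgeless⇒no-half-edge M h)) (root-same M.root)
  where
  module M = RootedMap M
  φ : M.system ≃ RootedMap.system dot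
  φ = record
    { onV = mk↔ₛ′ (λ _ → tt) (λ _ → M.rootVertex) (λ _ → refl)
        (isolated-unique′ M.rootVertex)
    ; onH = mk↔ₛ′ (edgeless⇒no-half-edge M) (λ ()) (λ ()) (λ h → ⊥-elim (edgeless⇒no-half-edge M h))
    ; vertex-comm = λ h → ⊥-elim (edgeless⇒no-half-edge M h)
    ; σ-comm = λ h → ⊥-elim (edgeless⇒no-half-edge M h) }
    where
    isolated-unique′ : ∀ v w → v ≡ w
    isolated-unique′ v w = isolated-unique M w (λ h → ⊥-elim (edgeless⇒no-half-edge M h)) v
  root-same : ∀ c → SameCorner≃ φ c (isolated tt λ ())
  root-same (before h)     = ⊥-elim (edgeless⇒no-half-edge M h)
  root-same (isolated _ _) = isolated refl

dots : Family 0
dots = record { Index = ⊤ ; size = 1 ; finite = ↔-sym 1↔⊤ ; map = λ _ → dot ; irredundant = λ _ _ _ → refl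
              ; c = λ _ → 0 ; c-correct = λ _ → edgeless dot }

none : ∀ n → Family n
none n = record { Index = ⊥ ; size = 0 ; finite = ↔-sym 0↔⊥ ; map = λ () ; irredundant = λ ()
                ; c = λ () ; c-correct = λ () }

-- The leg ensures that no corner is isolated, so the corners of `withRootLeg M₀` are numbered by
-- its 2n+1 half-edges, also when n = 0.
legHalfEdge : ∀ {n} (M₀ : RootedMap n) → Fin (suc (n * 2)) → H (withRootLeg M₀)
legHalfEdge M₀ j = from (finiteH (withRootLeg M₀)) (cast (cong suc (sym (RootedMap.edges M₀))) j)

legHalfEdge-injective : ∀ {n} (M₀ : RootedMap n) → Injective _≡_ _≡_ (legHalfEdge M₀)
legHalfEdge-injective M₀ p =
  Fin.toℕ-injective (trans (sym (Fin.toℕ-cast _ _)) (trans (cong Fin.toℕ (to-injective (↔-sym (finiteH (withRootLeg M₀))) p)) (Fin.toℕ-cast _ _)))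

legHalfEdge-surjective : ∀ {n} (M₀ : RootedMap n) x → ∃ λ j → legHalfEdge M₀ j ≡ x
legHalfEdge-surjective M₀ x =
  cast (cong suc (RootedMap.edges M₀)) (to e x) ,
  trans (cong (from e) (trans (Fin.cast-trans (cong suc (RootedMap.edges M₀)) (cong suc (sym (RootedMap.edges M₀))) (to e x)) (Fin.cast-is-id refl (to e x)))) (strictlyInverseʳ e x)
  where e = finiteH (withRootLeg M₀)

leg-corner : ∀ {n} (M₀ : RootedMap n) (c : Corner (withRootLeg M₀)) → ∃ λ j → c ≡ before (legHalfEdge M₀ j)
leg-corner M₀ (before x) with j , refl ← legHalfEdge-surjective M₀ x = j , refl
leg-corner M₀ (isolated v i) = contradiction (isolated-unique M₀ v (i ∘ just) (RootedMap.rootVertex M₀)) (i nothing)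

module Step (F : ∀ m → Family m) (n : ℕ) where
  private module F m = Family (F m)

  Join Extension : Set
  Join      = Antidiagonal F.Index F.Index n
  Extension = F.Index n × Fin (suc (n * 2))

  mapJoin : Join → RootedMap (suc n)
  mapJoin (a , b , refl , i , j) = join (F.map a i) (F.map b j)

  mapJoin-≅ : ∀ {a b} e i j → mapJoin (a , b , e , i , j) ≅ join (F.map a i) (F.map b j)
  mapJoin-≅ refl i j = ≅-refl

  mapExtension : Extension → RootedMap (suc n)
  mapExtension (i , j) = addEdge (F.map n i) (before (legHalfEdge (F.map n i) j))

  map : Join ⊎ Extension → RootedMap (suc n)
  map = Sum.[ mapJoin , mapExtension ]′

  c : Join ⊎ Extension → ℕ
  c (inj₁ (a , _ , _ , i , _)) = suc (F.c a i)
  c (inj₂ (i , _))             = F.c n i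

  Join-≡ : ∀ {a b a′ b′ e e′ i i′ j j′} → F.map a i ≅ F.map a′ i′ → F.map b j ≅ F.map b′ j′ →
           _≡_ {A = Join} (a , b , e , i , j) (a′ , b′ , e′ , i′ , j′)
  Join-≡ {a} {b} {e = e} {e′} {i} {j = j} φ ψ with ≅⇒edges≡ φ | ≅⇒edges≡ ψ
  ... | refl | refl with F.irredundant _ _ _ φ | F.irredundant _ _ _ ψ
  ... | refl | refl = cong (λ e → a , b , e , i , j) (ℕ.≡-irrelevant e e′)

  -- Rigidity enters here: a nontrivial automorphism of a representative could identify the edge
  -- additions at two different corners.
  Extension-≡ : ∀ {i j i′ j′} (φ : F.map n i ≅ F.map n i′) →
                SameCorner≃ (withRootLeg-cong φ) (before (legHalfEdge (F.map n i) j)) (before (legHalfEdge (F.map n i′) j′)) →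
                _≡_ {A = Extension} (i , j) (i′ , j′)
  Extension-≡ {i} φ (before p) with refl ← F.irredundant _ _ _ φ =
    cong (i ,_) (legHalfEdge-injective (F.map n i) (trans (sym (trivial _)) p))
    where
    trivial : ∀ x → Maybe.map (to (_≅_.onH φ)) x ≡ x
    trivial nothing  = refl
    trivial (just h) = cong just (automorphism-trivial _ φ h)

  irredundant : ∀ x y → map x ≅ map y → x ≡ y
  irredundant (inj₁ (a , b , e , i , j)) (inj₁ (a′ , b′ , e′ , i′ , j′)) φ =
    let φ₁ , φ₂ = join-cancel (≅-trans (≅-sym (mapJoin-≅ e i j)) (≅-trans φ (mapJoin-≅ e′ i′ j′)))
    in cong inj₁ (Join-≡ φ₁ φ₂)
  irredundant (inj₁ (a , b , e , i , j)) (inj₂ _) φ =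
    ⊥-elim (join≇addEdge _ _ _ _ (≅-trans (≅-sym φ) (mapJoin-≅ e i j)))
  irredundant (inj₂ _) (inj₁ (a , b , e , i , j)) φ =
    ⊥-elim (join≇addEdge _ _ _ _ (≅-trans φ (mapJoin-≅ e i j)))
  irredundant (inj₂ _) (inj₂ _) φ = let φ₀ , s = addEdge-cancel φ in cong inj₂ (Extension-≡ φ₀ s)

  c-correct : ∀ x → RootIsthmicParts (map x) (c x)
  c-correct (inj₁ (a , b , e , i , j)) = isthmic _ _ (mapJoin-≅ e i j) (F.c-correct a i)
  c-correct (inj₂ (i , _))             = nonIsthmic _ _ ≅-refl (F.c-correct n i)

  step : Family (suc n)
  step = record
    { Index = Join ⊎ Extension ; size = _
    ; finite = ↔-trans (Antidiagonal-↔ F.finite F.finite n ⊎-↔ ↔-trans (F.finite n ×-↔ ↔-refl) (↔-sym *↔×)) (↔-sym +↔⊎)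
    ; map = map ; irredundant = irredundant ; c = c ; c-correct = c-correct }

  step-complete : (∀ m → m ≤ n → Complete (F m)) → Complete step
  step-complete complete M = index (decompose M)
    where
    extend : ∀ {m} (M₀ : RootedMap m) d → M ≅ addEdge M₀ d → m ≡ n → ∃ λ x → M ≅ map x
    extend M₀ d φ refl =
      let i , p = complete n ℕ.≤-refl M₀
          d′ , s = image (withRootLeg-cong p) d
          j , q = leg-corner (F.map n i) d′
      in inj₂ (i , j) , ≅-trans φ (addEdge-cong p (subst (SameCorner≃ (withRootLeg-cong p) d) q s))
    index : Decomposition M → ∃ λ x → M ≅ map x
    index (isthmic {a} {b} M₁ M₂ φ) =
      let e     = ℕ.suc-injective (sym (≅⇒edges≡ φ))
          i , p = complete a (subst (a ≤_) e (ℕ.m≤m+n a b)) M₁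
          j , q = complete b (subst (b ≤_) e (ℕ.m≤n+m b a)) M₂
      in inj₁ (a , b , e , i , j) , ≅-trans φ (≅-trans (join-cong p q) (≅-sym (mapJoin-≅ e i j)))
    index (nonIsthmic M₀ d φ) = extend M₀ d φ (sym (ℕ.suc-injective (≅⇒edges≡ φ)))

-- Allowing incomplete families makes the recursion structural: stage t is complete only up to t edges.
stage : ℕ → ∀ n → Family n
stage t       zero    = dots
stage zero    (suc n) = none (suc n)
stage (suc t) (suc n) = Step.step (stage t) n

stage-complete : ∀ t n → n ≤ t → Complete (stage t n)
stage-complete zero    zero    _       M = tt , dot-unique M
stage-complete (suc t) zero    _       M = tt , dot-unique M
stage-complete (suc t) (suc n) (s≤s p) M = Step.step-complete (stage t) n (λ m q → stage-complete t m (ℕ.≤-trans q p)) M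

uniform : ∀ {n} (F : Family n) → Complete F → UniformRootedMap n
uniform F complete = record
  { size = size ; map = map ∘ from finite
  ; complete = λ M → let i , φ = complete M in
      to finite i , subst (λ i → M ≅ map i) (sym (strictlyInverseʳ finite i)) φ
  ; irredundant = λ i j φ → to-injective (↔-sym finite) (irredundant _ _ φ)
  ; c = c ∘ from finite ; c-correct = c-correct ∘ from finite }
  where open Family F using (size; finite; map; irredundant; c; c-correct)

uniformRootedMap : ∀ n → UniformRootedMap n
uniformRootedMap n = uniform (stage n n) (stage-complete n n ℕ.≤-refl)

family : ∀ {n} → UniformRootedMap n → Family n
family Ω = record { Index = Fin size ; size = size ; finite = ↔-refl ; map = map ; irredundant = irredundant
                  ; c = c ; c-correct = c-correct }
  where open UniformRootedMap Ω

Index-↔ : ∀ {n} (F G : Family n) → Complete F → Complete G → Index F ↔ Index G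
Index-↔ F G p q = mk↔ₛ′ (λ i → proj₁ (q (F.map i))) (λ j → proj₁ (p (G.map j)))
  (λ j → G.irredundant _ _ (≅-trans (≅-sym (proj₂ (q _))) (≅-sym (proj₂ (p _)))))
  (λ i → F.irredundant _ _ (≅-trans (≅-sym (proj₂ (p _))) (≅-sym (proj₂ (q _)))))
  where
  module F = Family F
  module G = Family G

Class-↔ : ∀ {n} (F G : Family n) → Complete F → Complete G → ∀ k → Class F k ↔ Class G k
Class-↔ F G p q k = Σ-↔ (ℕ.≡-irrelevant) (ℕ.≡-irrelevant) (Index-↔ F G p q)
  (λ {i} e → trans (parts-unique (≅-sym (proj₂ (q (F.map i)))) (G.c-correct _) (F.c-correct i)) e)
  (λ {j} e → trans (parts-unique (≅-sym (proj₂ (p (G.map j)))) (F.c-correct _) (G.c-correct j)) e)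
  where
  module F = Family F
  module G = Family G

Σ-⊎ : ∀ {A B : Set} {P : A ⊎ B → Set} → Σ (A ⊎ B) P ↔ (Σ A (P ∘ inj₁) ⊎ Σ B (P ∘ inj₂))
Σ-⊎ = mk↔ₛ′ (λ { (inj₁ a , p) → inj₁ (a , p) ; (inj₂ b , p) → inj₂ (b , p) })
  Sum.[ (λ { (a , p) → inj₁ a , p }) , (λ { (b , p) → inj₂ b , p }) ]′
  (λ { (inj₁ _) → refl ; (inj₂ _) → refl }) (λ { (inj₁ _ , _) → refl ; (inj₂ _ , _) → refl })

-- The given `Ω (suc n)` is not built from smaller maps, but `S.step n` is a second complete family
-- with the same number of edges, built from the `Ω m`. The bijections between the two, overall and
-- class by class, give the recurrences for Ω itself.
module Recurrences (Ω : ∀ n → UniformRootedMap n) where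
  private
    module Ω n = UniformRootedMap (Ω n)
    F : ∀ n → Family n
    F n = family (Ω n)
    module S n = Step F n

  total : ℕ → ℕ
  total = Ω.size

  count : ℕ → ℕ → ℕ
  count n k = length (filter (λ i → Ω.c n i ℕ.≟ k) (allFin (Ω.size n)))

  private
    step-complete : ∀ n → Complete (S.step n)
    step-complete n = S.step-complete n (λ m _ → Ω.complete m)

    class-finite : ∀ n k → Class (F n) k ↔ Fin (count n k)
    class-finite n k = filter-↔ (λ i → Ω.c n i ℕ.≟ k) ℕ.≡-irrelevant id

    extension-finite : ∀ n k → Σ (S.Extension n) (λ x → S.c n (inj₂ x) ≡ k) ↔ Fin (count n k * suc (n * 2))
    extension-finite n k = ↔-trans
      (mk↔ₛ′ (λ { ((i , j) , p) → (i , p) , j }) (λ { ((i , p) , j) → (i , j) , p }) (λ _ → refl) (λ _ → refl))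
      (↔-trans (class-finite n k ×-↔ ↔-refl) (↔-sym *↔×))

    join-finite : ∀ n k → Σ (S.Join n) (λ x → S.c n (inj₁ x) ≡ suc k) ↔ Fin (conv (λ m → count m k) total n)
    join-finite n k = ↔-trans
      (mk↔ₛ′ (λ { ((a , b , e , i , j) , p) → a , b , e , (i , ℕ.suc-injective p) , j })
             (λ { (a , b , e , (i , p) , j) → (a , b , e , i , j) , cong suc p })
             (λ { (a , b , e , (i , p) , j) → cong (λ p → a , b , e , (i , p) , j) (ℕ.≡-irrelevant _ _) })
             (λ { (x , p) → cong (x ,_) (ℕ.≡-irrelevant _ _) }))
      (Antidiagonal-↔ {F = λ m → Class (F m) k} (λ m → class-finite m k) (λ m → ↔-refl) n)

  total-zero : total 0 ≡ 1
  total-zero = ↔⇒≡ (↔-trans (Index-↔ (F 0) dots (Ω.complete 0) (λ M → tt , dot-unique M)) (↔-sym 1↔⊤))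

  count-zero-zero : count 0 0 ≡ 1
  count-zero-zero = ↔⇒≡ (↔-trans (↔-sym (class-finite 0 0))
    (↔-trans (Class-↔ (F 0) dots (Ω.complete 0) (λ M → tt , dot-unique M) 0)
      (↔-trans (mk↔ₛ′ (λ _ → tt) (λ _ → tt , refl) (λ _ → refl) (λ { (tt , refl) → refl })) (↔-sym 1↔⊤))))

  count-zero-suc : ∀ k → count 0 (suc k) ≡ 0
  count-zero-suc k = ↔⇒≡ (↔-trans (↔-sym (class-finite 0 (suc k)))
    (↔-trans (Class-↔ (F 0) dots (Ω.complete 0) (λ M → tt , dot-unique M) (suc k))
      (mk↔ₛ′ (λ { (_ , ()) }) (λ ()) (λ ()) (λ { (_ , ()) }))))

  count≤total : ∀ n k → count n k ≤ total n
  count≤total n k = subst (count n k ≤_) (length-tabulate id)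
    (length-filter (λ i → Ω.c n i ℕ.≟ k) (allFin (Ω.size n)))

  total-suc : ∀ n → total (suc n) ≡ conv total total n + total n * suc (n * 2)
  total-suc n = ↔⇒≡ (↔-trans (Index-↔ (F (suc n)) (S.step n) (Ω.complete (suc n)) (step-complete n))
                             (Family.finite (S.step n)))

  count-suc-zero : ∀ n → count (suc n) 0 ≡ count n 0 * suc (n * 2)
  count-suc-zero n = ↔⇒≡ (↔-trans (↔-sym (class-finite (suc n) 0))
    (↔-trans (Class-↔ (F (suc n)) (S.step n) (Ω.complete (suc n)) (step-complete n) 0)
      (↔-trans Σ-⊎ (↔-trans no-join (extension-finite n 0)))))
    where
    no-join : ∀ {A B : Set} {f : A → ℕ} → (Σ A (λ a → suc (f a) ≡ 0) ⊎ B) ↔ B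
    no-join = mk↔ₛ′ (λ { (inj₁ (_ , ())) ; (inj₂ b) → b }) inj₂ (λ _ → refl) (λ { (inj₁ (_ , ())) ; (inj₂ _) → refl })

  count-suc-suc : ∀ n k → count (suc n) (suc k) ≡ conv (λ m → count m k) total n + count n (suc k) * suc (n * 2)
  count-suc-suc n k = ↔⇒≡ (↔-trans (↔-sym (class-finite (suc n) (suc k)))
    (↔-trans (Class-↔ (F (suc n)) (S.step n) (Ω.complete (suc n)) (step-complete n) (suc k))
      (↔-trans Σ-⊎ (↔-trans (join-finite n k ⊎-↔ extension-finite n (suc k)) (↔-sym +↔⊎)))))

-- Asymptotics

conv-cong : ∀ {f f′ g g′} n → (∀ m → m ≤ n → f m ≡ f′ m) → (∀ m → m ≤ n → g m ≡ g′ m) → conv f g n ≡ conv f′ g′ n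
conv-cong zero    p q = cong₂ _*_ (p 0 z≤n) (q 0 z≤n)
conv-cong (suc n) p q = cong₂ _+_ (cong₂ _*_ (p 0 z≤n) (q (suc n) ℕ.≤-refl))
  (conv-cong n (λ m m≤n → p (suc m) (s≤s m≤n)) (λ m m≤n → q m (ℕ.m≤n⇒m≤1+n m≤n)))

conv-mono : ∀ {f f′ g g′} n → (∀ m → f m ≤ f′ m) → (∀ m → g m ≤ g′ m) → conv f g n ≤ conv f′ g′ n
conv-mono zero    p q = ℕ.*-mono-≤ (p 0) (q 0)
conv-mono (suc n) p q = ℕ.+-mono-≤ (ℕ.*-mono-≤ (p 0) (q (suc n))) (conv-mono n (p ∘ suc) q)

conv-linear : ∀ c f g h n → conv (λ i → c * f i + g i) h n ≡ c * conv f h n + conv g h n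
conv-linear c f g h zero    = identity c (f 0) (g 0) (h 0)
  where
  identity : ∀ c x y z → (c * x + y) * z ≡ c * (x * z) + y * z
  identity = solve-∀
conv-linear c f g h (suc n) = trans
  (cong ((c * f 0 + g 0) * h (suc n) +_) (conv-linear c (f ∘ suc) (g ∘ suc) h n))
  (identity c (f 0) (g 0) (h (suc n)) (conv (f ∘ suc) h n) (conv (g ∘ suc) h n))
  where
  identity : ∀ c x y z s t → (c * x + y) * z + (c * s + t) ≡ c * (x * z + s) + (y * z + t)
  identity = solve-∀

conv-assoc : ∀ f g h n → conv (conv f g) h n ≡ conv f (conv g h) n
conv-assoc f g h zero    = ℕ.*-assoc (f 0) (g 0) (h 0)
conv-assoc f g h (suc n) = begin
  f 0 * g 0 * h (suc n) + conv (λ i → f 0 * g (suc i) + conv (f ∘ suc) g i) h n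
    ≡⟨ cong (f 0 * g 0 * h (suc n) +_) (conv-linear (f 0) (g ∘ suc) (conv (f ∘ suc) g) h n) ⟩
  f 0 * g 0 * h (suc n) + (f 0 * conv (g ∘ suc) h n + conv (conv (f ∘ suc) g) h n)
    ≡⟨ cong (λ x → f 0 * g 0 * h (suc n) + (f 0 * conv (g ∘ suc) h n + x)) (conv-assoc (f ∘ suc) g h n) ⟩
  f 0 * g 0 * h (suc n) + (f 0 * conv (g ∘ suc) h n + conv (f ∘ suc) (conv g h) n)
    ≡⟨ identity (f 0) (g 0) (h (suc n)) (conv (g ∘ suc) h n) (conv (f ∘ suc) (conv g h) n) ⟩
  f 0 * (g 0 * h (suc n) + conv (g ∘ suc) h n) + conv (f ∘ suc) (conv g h) n ∎
  where
  open ≡-Reasoning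
  identity : ∀ a b c d e → a * b * c + (a * d + e) ≡ a * (b * c + d) + e
  identity = solve-∀

conv-last : ∀ f g n → conv f g (suc n) ≡ conv f (g ∘ suc) n + f (suc n) * g 0
conv-last f g zero    = refl
conv-last f g (suc n) = trans (cong (f 0 * g (suc (suc n)) +_) (conv-last (f ∘ suc) g n))
  (sym (ℕ.+-assoc (f 0 * g (suc (suc n))) (conv (f ∘ suc) (g ∘ suc) n) (f (suc (suc n)) * g 0)))

last≤conv : ∀ f g n → f n * g 0 ≤ conv f g n
last≤conv f g zero    = ℕ.≤-refl
last≤conv f g (suc n) = subst (f (suc n) * g 0 ≤_) (sym (conv-last f g n)) (ℕ.m≤n+m _ _)

-- If f (i+1) = f i · (2i+p), the weighted factor is the shift of f: this gives recurrences for convolutions of double factorials.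
conv-weight : ∀ p q f g n → conv (λ i → f i * (p + i * 2)) g n + conv f (λ j → g j * (q + j * 2)) n ≡
                            conv f g n * (p + q + n * 2)
conv-weight p q f g zero    = identity p q (f 0) (g 0)
  where
  identity : ∀ p q x y → x * (p + 0) * y + x * (y * (q + 0)) ≡ x * y * (p + q + 0)
  identity = solve-∀
conv-weight p q f g (suc n) = begin
  f 0 * (p + 0) * g (suc n) + conv (λ i → f (suc i) * (p + (2 + i * 2))) g n +
    (f 0 * (g (suc n) * (q + (2 + n * 2))) + conv (f ∘ suc) (λ j → g j * (q + j * 2)) n)
    ≡⟨ cong (λ x → f 0 * (p + 0) * g (suc n) + x + (f 0 * (g (suc n) * (q + (2 + n * 2))) + conv (f ∘ suc) (λ j → g j * (q + j * 2)) n))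
         (conv-cong n (λ m _ → cong (f (suc m) *_) (shift p (m * 2))) (λ _ _ → refl)) ⟩
  f 0 * (p + 0) * g (suc n) + conv (λ i → f (suc i) * (2 + p + i * 2)) g n +
    (f 0 * (g (suc n) * (q + (2 + n * 2))) + conv (f ∘ suc) (λ j → g j * (q + j * 2)) n)
    ≡⟨ regroup p q (f 0) (g (suc n)) n (conv (λ i → f (suc i) * (2 + p + i * 2)) g n) (conv (f ∘ suc) (λ j → g j * (q + j * 2)) n) ⟩
  f 0 * g (suc n) * (p + q + (2 + n * 2)) +
    (conv (λ i → f (suc i) * (2 + p + i * 2)) g n + conv (f ∘ suc) (λ j → g j * (q + j * 2)) n)
    ≡⟨ cong (f 0 * g (suc n) * (p + q + (2 + n * 2)) +_) (conv-weight (2 + p) q (f ∘ suc) g n) ⟩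
  f 0 * g (suc n) * (p + q + (2 + n * 2)) + conv (f ∘ suc) g n * (2 + p + q + n * 2)
    ≡⟨ factor p q (f 0 * g (suc n)) (conv (f ∘ suc) g n) n ⟩
  (f 0 * g (suc n) + conv (f ∘ suc) g n) * (p + q + (2 + n * 2)) ∎
  where
  open ≡-Reasoning
  shift : ∀ p x → p + (2 + x) ≡ 2 + p + x
  shift = solve-∀
  regroup : ∀ p q x y n s t → x * (p + 0) * y + s + (x * (y * (q + (2 + n * 2))) + t) ≡
                              x * y * (p + q + (2 + n * 2)) + (s + t)
  regroup = solve-∀
  factor : ∀ p q x y n → x * (p + q + (2 + n * 2)) + y * (2 + p + q + n * 2) ≡ (x + y) * (p + q + (2 + n * 2))
  factor = solve-∀

-- The part of the Cauchy product in which both indices are positive.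
inner : (ℕ → ℕ) → (ℕ → ℕ) → ℕ → ℕ
inner f g zero          = 0
inner f g (suc zero)    = 0
inner f g (suc (suc n)) = conv (f ∘ suc) (g ∘ suc) n

conv-inner : ∀ f g n → conv f g (suc n) ≡ f 0 * g (suc n) + inner f g (suc n) + f (suc n) * g 0
conv-inner f g zero    = cong (_+ f 1 * g 0) (sym (ℕ.+-identityʳ (f 0 * g 1)))
conv-inner f g (suc n) = trans (cong (f 0 * g (suc (suc n)) +_) (conv-last (f ∘ suc) g n))
  (sym (ℕ.+-assoc (f 0 * g (suc (suc n))) (conv (f ∘ suc) (g ∘ suc) n) (f (suc (suc n)) * g 0)))

inner-mono : ∀ {f f′ g g′} n → (∀ m → f m ≤ f′ m) → (∀ m → g m ≤ g′ m) → inner f g n ≤ inner f′ g′ n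
inner-mono zero          p q = z≤n
inner-mono (suc zero)    p q = z≤n
inner-mono (suc (suc n)) p q = conv-mono n (p ∘ suc) (q ∘ suc)

-- (2n-1)!! and (2n)!!
odd!! even!! : ℕ → ℕ
odd!!  zero    = 1
odd!!  (suc n) = odd!! n * (1 + n * 2)
even!! zero    = 1
even!! (suc n) = even!! n * (2 + n * 2)

odd!!≤even!! : ∀ n → odd!! n ≤ even!! n
odd!!≤even!! zero    = ℕ.≤-refl
odd!!≤even!! (suc n) = ℕ.*-mono-≤ (odd!!≤even!! n) (ℕ.n≤1+n _)

1≤even!! : ∀ n → 1 ≤ even!! n
1≤even!! zero    = ℕ.≤-refl
1≤even!! (suc n) = ℕ.*-mono-≤ (1≤even!! n) (s≤s (z≤n {1 + n * 2}))

-- Put d i = (2i+3)!!. Peeling the first term off one copy of `conv d d (suc n)` and the last off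
-- another leaves two shifted convolutions, which `conv-weight` adds up: twice the new value is
-- (2n+10) times the old one plus 6 · d (n+1). The constant 18 is the least C for which this
-- induction closes at n = 0, where it needs 10C + 36 ≤ 12C.
odd!!-square : ∀ n → conv (λ i → odd!! (2 + i)) (λ i → odd!! (2 + i)) n ≤ 18 * even!! (2 + n)
odd!!-square zero    = ℕ.m≤m+n 9 135
odd!!-square (suc n) = ℕ.*-cancelˡ-≤ 2 (begin
  2 * conv d d (suc n)
    ≡⟨ double ⟩
  conv d d n * (10 + n * 2) + 6 * d (suc n)
    ≤⟨ ℕ.+-mono-≤ (ℕ.*-monoˡ-≤ (10 + n * 2) (odd!!-square n)) (ℕ.*-monoʳ-≤ 6 (odd!!≤even!! (3 + n))) ⟩
  18 * even!! (2 + n) * (10 + n * 2) + 6 * (even!! (2 + n) * (2 + (2 + n) * 2))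
    ≤⟨ ℕ.m≤m+n _ (even!! (2 + n) * (24 * n)) ⟩
  18 * even!! (2 + n) * (10 + n * 2) + 6 * (even!! (2 + n) * (2 + (2 + n) * 2)) + even!! (2 + n) * (24 * n)
    ≡⟨ bound (even!! (2 + n)) n ⟩
  2 * (18 * even!! (3 + n)) ∎)
  where
  open ℕ.≤-Reasoning
  d : ℕ → ℕ
  d i = odd!! (2 + i)
  bound : ∀ w n → 18 * w * (10 + n * 2) + 6 * (w * (2 + (2 + n) * 2)) + w * (24 * n) ≡ 2 * (18 * (w * (2 + (2 + n) * 2)))
  bound = solve-∀
  first : ∀ c → 3 * d (suc n) + conv (d ∘ suc) d n + (conv d (d ∘ suc) n + d (suc n) * 3) ≡ c → 2 * conv d d (suc n) ≡ c
  first c p = trans (trans (cong (conv d d (suc n) +_) (ℕ.+-identityʳ _)) (cong (conv d d (suc n) +_) (conv-last d d n))) p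
  rearrange : ∀ x y z → 3 * x + y + (z + x * 3) ≡ y + z + 6 * x
  rearrange = solve-∀
  double : 2 * conv d d (suc n) ≡ conv d d n * (10 + n * 2) + 6 * d (suc n)
  double = first _ (trans (rearrange (d (suc n)) (conv (d ∘ suc) d n) (conv d (d ∘ suc) n))
    (cong (_+ 6 * d (suc n)) (conv-weight 5 5 d d n)))

-- An inequality of Wallis type; its induction step is 4(n+1)(n+2) + 1 = (2n+3)².
even!!²≤odd!!² : ∀ n → even!! n * even!! n * (1 + n) ≤ odd!! (suc n) * odd!! (suc n)
even!!²≤odd!!² zero    = ℕ.≤-refl
even!!²≤odd!!² (suc n) = begin
  even!! n * (2 + n * 2) * (even!! n * (2 + n * 2)) * (2 + n)
    ≡⟨ regroup (even!! n) n ⟩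
  even!! n * even!! n * (1 + n) * (4 * (1 + n) * (2 + n))
    ≤⟨ ℕ.*-mono-≤ (even!!²≤odd!!² n) (ℕ.n≤1+n _) ⟩
  odd!! (suc n) * odd!! (suc n) * suc (4 * (1 + n) * (2 + n))
    ≡⟨ square (odd!! (suc n)) n ⟩
  odd!! (suc n) * (1 + suc n * 2) * (odd!! (suc n) * (1 + suc n * 2)) ∎
  where
  open ℕ.≤-Reasoning
  regroup : ∀ w n → w * (2 + n * 2) * (w * (2 + n * 2)) * (2 + n) ≡ w * w * (1 + n) * (4 * (1 + n) * (2 + n))
  regroup = solve-∀
  square : ∀ d n → d * d * suc (4 * (1 + n) * (2 + n)) ≡ d * (1 + suc n * 2) * (d * (1 + suc n * 2))
  square = solve-∀

-- Bounds on a n, and the error of 2ᵏ · A n k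

module Asymptotics (a : ℕ → ℕ) (A : ℕ → ℕ → ℕ)
  (a-zero : a 0 ≡ 1) (a-suc : ∀ n → a (suc n) ≡ conv a a n + a n * (1 + n * 2))
  (A≤a : ∀ n k → A n k ≤ a n) (A-zero-zero : A 0 0 ≡ 1) (A-zero-suc : ∀ k → A 0 (suc k) ≡ 0)
  (A-suc-zero : ∀ n → A (suc n) 0 ≡ A n 0 * (1 + n * 2))
  (A-suc-suc : ∀ n k → A (suc n) (suc k) ≡ conv (λ m → A m k) a n + A n (suc k) * (1 + n * 2)) where

  -- Rooted maps with n edges correspond to indecomposable matchings of 2n+2 points.
  conv-odd!! : ∀ n → conv a odd!! n ≡ odd!! (suc n)
  conv-odd!! = <-rec _ step
    where
    open ≡-Reasoning
    step : ∀ n → (∀ {m} → m < n → conv a odd!! m ≡ odd!! (suc m)) → conv a odd!! n ≡ odd!! (suc n)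
    step zero    _  = cong (_* 1) a-zero
    step (suc n) ih = begin
      a 0 * odd!! (suc n) + conv (a ∘ suc) odd!! n
        ≡⟨ cong₂ _+_ (trans (cong (_* odd!! (suc n)) a-zero) (ℕ.*-identityˡ _))
                     (conv-cong n (λ m _ → trans (a-suc m) (cong (_+ a m * (1 + m * 2)) (sym (ℕ.*-identityˡ _)))) (λ _ _ → refl)) ⟩
      odd!! (suc n) + conv (λ m → 1 * conv a a m + a m * (1 + m * 2)) odd!! n
        ≡⟨ cong (odd!! (suc n) +_) (conv-linear 1 (conv a a) (λ m → a m * (1 + m * 2)) odd!! n) ⟩
      odd!! (suc n) + (1 * conv (conv a a) odd!! n + conv (λ m → a m * (1 + m * 2)) odd!! n)
        -- Associativity turns the quadratic term into a convolution of `a` with `conv a odd!!`, to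
        -- which the induction hypothesis applies at all indices up to n.
        ≡⟨ cong (λ x → odd!! (suc n) + (x + conv (λ m → a m * (1 + m * 2)) odd!! n))
             (trans (ℕ.*-identityˡ _) (trans (conv-assoc a a odd!! n)
                (conv-cong n (λ _ _ → refl) (λ m m≤n → ih (s≤s m≤n))))) ⟩
      odd!! (suc n) + (conv a (odd!! ∘ suc) n + conv (λ m → a m * (1 + m * 2)) odd!! n)
        ≡⟨ cong (odd!! (suc n) +_) (trans (ℕ.+-comm (conv a (odd!! ∘ suc) n) _) (conv-weight 1 1 a odd!! n)) ⟩
      odd!! (suc n) + conv a odd!! n * (2 + n * 2)
        ≡⟨ cong (λ x → odd!! (suc n) + x * (2 + n * 2)) (ih ℕ.≤-refl) ⟩
      odd!! (suc n) + odd!! (suc n) * (2 + n * 2)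
        ≡⟨ sym (ℕ.*-suc (odd!! (suc n)) (2 + n * 2)) ⟩
      odd!! (suc n) * (1 + suc n * 2) ∎

  -- `a n` is the last term of the convolution in `conv-odd!!`.
  a≤odd!! : ∀ n → a n ≤ odd!! (suc n)
  a≤odd!! n = subst (_≤ odd!! (suc n)) (ℕ.*-identityʳ (a n)) (subst (a n * 1 ≤_) (conv-odd!! n) (last≤conv a odd!! n))

  inner-bound : ∀ n → inner a a n ≤ 18 * even!! n
  inner-bound zero          = z≤n
  inner-bound (suc zero)    = z≤n
  inner-bound (suc (suc n)) = ℕ.≤-trans (conv-mono n (a≤odd!! ∘ suc) (a≤odd!! ∘ suc)) (odd!!-square n)

  a-one : a 1 ≡ 2
  a-one = trans (a-suc 0) (cong₂ (λ x y → x * y + x * 1) a-zero a-zero)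

  -- The two end terms of the convolution, each `a (suc n)`, raise the coefficient by 2.
  a-suc-suc : ∀ n → a (2 + n) ≡ inner a a (suc n) + a (suc n) * (3 + suc n * 2)
  a-suc-suc n = trans (a-suc (suc n)) (trans (cong (_+ a (suc n) * (1 + suc n * 2))
      (trans (conv-inner a a n) (cong (λ x → x * a (suc n) + inner a a (suc n) + a (suc n) * x) a-zero)))
    (regroup (a (suc n)) (inner a a (suc n)) n))
    where
    regroup : ∀ x t n → 1 * x + t + x * 1 + x * (1 + suc n * 2) ≡ t + x * (3 + suc n * 2)
    regroup = solve-∀

  -- Without its inner terms `a-suc-suc` multiplies by the same factor as `odd!!`, so the ratio is
  -- settled at n = 1, where 3 ≤ 2 · 2.
  odd!!≤2a : ∀ n → odd!! (suc n) ≤ 2 * a n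
  odd!!≤2a zero          = subst (λ x → 1 ≤ 2 * x) (sym a-zero) (s≤s z≤n)
  odd!!≤2a (suc zero)    = subst (λ x → 3 ≤ 2 * x) (sym a-one) (ℕ.n≤1+n 3)
  odd!!≤2a (suc (suc n)) = begin
    odd!! (suc (suc n)) * (3 + suc n * 2)                    ≤⟨ ℕ.*-monoˡ-≤ (3 + suc n * 2) (odd!!≤2a (suc n)) ⟩
    2 * a (suc n) * (3 + suc n * 2)                          ≡⟨ ℕ.*-assoc 2 (a (suc n)) (3 + suc n * 2) ⟩
    2 * (a (suc n) * (3 + suc n * 2))                        ≤⟨ ℕ.*-monoʳ-≤ 2 (ℕ.m≤n+m _ (inner a a (suc n))) ⟩
    2 * (inner a a (suc n) + a (suc n) * (3 + suc n * 2))    ≡⟨ cong (2 *_) (sym (a-suc-suc n)) ⟩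
    2 * a (2 + n)                                            ∎
    where open ℕ.≤-Reasoning

  -- The end terms of the convolution in A-suc-suc, so that Σ A i k · a (n-i) is ends n k plus inner terms.
  ends : ℕ → ℕ → ℕ
  ends n k = A 0 k * a n + A n k

  ends-zero : ∀ n → ends n 0 ≡ a n + A n 0
  ends-zero n = cong (_+ A n 0) (trans (cong (_* a n) A-zero-zero) (ℕ.*-identityˡ (a n)))

  ends-suc : ∀ n k → ends n (suc k) ≡ A n (suc k)
  ends-suc n k = cong (λ x → x * a n + A n (suc k)) (A-zero-suc k)

  A-step : ∀ n k → A (2 + n) (suc k) ≡ ends (suc n) k + inner (λ m → A m k) a (suc n) + A (suc n) (suc k) * (1 + suc n * 2)
  A-step n k = trans (A-suc-suc (suc n) k) (cong (_+ A (suc n) (suc k) * (1 + suc n * 2)) (trans (conv-inner (λ m → A m k) a n)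
    (trans (cong (λ x → A 0 k * a (suc n) + inner (λ m → A m k) a (suc n) + A (suc n) k * x) a-zero)
      (regroup (A 0 k * a (suc n)) (inner (λ m → A m k) a (suc n)) (A (suc n) k)))))
    where
    regroup : ∀ x t y → x + t + y * 1 ≡ x + y + t
    regroup = solve-∀

  -- |x - a n| ≤ C · (2n)!!, without subtraction.
  Near : ℕ → ℕ → ℕ → Set
  Near C n x = x ≤ a n + C * even!! n × a n ≤ x + C * even!! n

  -- With no isthmic construction only edge additions occur, with 1, 3, 5, ... choices in turn:
  -- these are the one-vertex maps.
  A-zero : ∀ n → A n 0 ≡ odd!! n
  A-zero zero    = A-zero-zero
  A-zero (suc n) = trans (A-suc-zero n) (cong (_* (1 + n * 2)) (A-zero n))

  A-zero-bound : ∀ n → A n 0 ≤ 1 * even!! n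
  A-zero-bound n = subst (A n 0 ≤_) (sym (ℕ.*-identityˡ _)) (subst (_≤ even!! n) (sym (A-zero n)) (odd!!≤even!! n))

  -- The error newly made in one step, as a multiple of (2n)!!: 2 · `bound k` from the end terms and
  -- 18 · 2^(k+1) from the inner ones. It can be its own bound because (2n+2)!! = (2n+1) · (2n)!! +
  -- (2n)!!: the first summand carries the inherited error, the second absorbs the new one.
  bound : ℕ → ℕ
  bound zero    = 1
  bound (suc k) = 2 * bound k + 18 * 2 ^ suc k

  -- For the base cases n = 0 and n = 1 of the induction: there a n ≤ 2 ≤ 18, and the summand 18 ·
  -- 2^(k+1) of the bound suffices.
  small-bound : ∀ n k → a n ≤ 2 → 2 ^ suc k * a n ≤ bound (suc k) * even!! n
  small-bound n k a≤2 = begin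
    2 ^ suc k * a n         ≤⟨ ℕ.*-monoʳ-≤ (2 ^ suc k) (ℕ.≤-trans a≤2 (ℕ.m≤m+n 2 16)) ⟩
    2 ^ suc k * 18          ≡⟨ ℕ.*-comm (2 ^ suc k) 18 ⟩
    18 * 2 ^ suc k          ≤⟨ ℕ.m≤n+m _ (2 * bound k) ⟩
    bound (suc k)           ≡⟨ sym (ℕ.*-identityʳ _) ⟩
    bound (suc k) * 1       ≤⟨ ℕ.*-monoʳ-≤ (bound (suc k)) (1≤even!! n) ⟩
    bound (suc k) * even!! n ∎
    where open ℕ.≤-Reasoning

  1≤2^ : ∀ k → 1 ≤ 2 ^ k
  1≤2^ k = ℕ.m^n>0 2 k

  small : ∀ n k → a n ≤ 2 → Near (bound (suc k)) n (2 ^ suc k * A n (suc k))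
  small n k a≤2 =
    ℕ.≤-trans (ℕ.*-monoʳ-≤ (2 ^ suc k) (A≤a n (suc k))) (ℕ.≤-trans (small-bound n k a≤2) (ℕ.m≤n+m _ _)) ,
    ℕ.≤-trans (subst (_≤ 2 ^ suc k * a n) (ℕ.*-identityˡ (a n)) (ℕ.*-monoˡ-≤ (a n) (1≤2^ (suc k))))
      (ℕ.≤-trans (small-bound n k a≤2) (ℕ.m≤n+m _ _))

  -- Splitting the coefficient 5 + 2n of `a-suc-suc` as 2 + (3 + 2n) aligns it with 2^(k+1) times
  -- `A-step`: 2 · a (n+1) faces 2 · (2ᵏ · ends), and the remaining terms have the common factor 3 +
  -- 2n. The inner terms are error on either side.
  near-step : ∀ k n → Near (bound k) (suc n) (2 ^ k * ends (suc n) k) →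
              Near (bound (suc k)) (suc n) (2 ^ suc k * A (suc n) (suc k)) →
              Near (bound (suc k)) (2 + n) (2 ^ suc k * A (2 + n) (suc k))
  near-step k n ih-ends ih = upper , lower
    where
    open ℕ.≤-Reasoning
    p = 2 ^ k
    w = even!! (suc n)
    e = ends (suc n) k
    x = A (suc n) (suc k)
    y = a (suc n)
    t = inner a a (suc n)
    t′ = inner (λ m → A m k) a (suc n)
    t′≤t : t′ ≤ t
    t′≤t = inner-mono (suc n) (λ m → A≤a m k) (λ _ → ℕ.≤-refl)
    upper : 2 * p * A (2 + n) (suc k) ≤ a (2 + n) + bound (suc k) * even!! (2 + n)
    upper = begin
      2 * p * A (2 + n) (suc k)
        ≡⟨ cong (2 * p *_) (A-step n k) ⟩
      2 * p * (e + t′ + x * (3 + n * 2))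
        ≡⟨ expand p e t′ x n ⟩
      2 * (p * e) + 2 * p * t′ + 2 * p * x * (3 + n * 2)
        ≤⟨ ℕ.+-mono-≤ (ℕ.+-mono-≤ (ℕ.*-monoʳ-≤ 2 (proj₁ ih-ends))
             (ℕ.*-monoʳ-≤ (2 * p) (ℕ.≤-trans t′≤t (inner-bound (suc n)))))
             (ℕ.*-monoˡ-≤ (3 + n * 2) (proj₁ ih)) ⟩
      2 * (y + bound k * w) + 2 * p * (18 * w) + (y + bound (suc k) * w) * (3 + n * 2)
        ≤⟨ ℕ.m≤n+m _ t ⟩
      t + (2 * (y + bound k * w) + 2 * p * (18 * w) + (y + bound (suc k) * w) * (3 + n * 2))
        ≡⟨ collect t y (bound k) w p n ⟩
      t + y * (5 + n * 2) + bound (suc k) * (w * (4 + n * 2))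
        ≡⟨ cong (_+ bound (suc k) * (w * (4 + n * 2))) (sym (a-suc-suc n)) ⟩
      a (2 + n) + bound (suc k) * even!! (2 + n) ∎
      where
      expand : ∀ p e t x n → 2 * p * (e + t + x * (3 + n * 2)) ≡ 2 * (p * e) + 2 * p * t + 2 * p * x * (3 + n * 2)
      expand = solve-∀
      collect : ∀ t y b w p n → t + (2 * (y + b * w) + 2 * p * (18 * w) + (y + (2 * b + 18 * (2 * p)) * w) * (3 + n * 2)) ≡
                                t + y * (5 + n * 2) + (2 * b + 18 * (2 * p)) * (w * (4 + n * 2))
      collect = solve-∀
    lower : a (2 + n) ≤ 2 * p * A (2 + n) (suc k) + bound (suc k) * even!! (2 + n)
    lower = begin
      a (2 + n)
        ≡⟨ a-suc-suc n ⟩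
      t + y * (5 + n * 2)
        ≡⟨ split t y n ⟩
      t + 2 * y + y * (3 + n * 2)
        ≤⟨ ℕ.+-mono-≤ (ℕ.+-mono-≤ (inner-bound (suc n)) (ℕ.*-monoʳ-≤ 2 (proj₂ ih-ends))) (ℕ.*-monoˡ-≤ (3 + n * 2) (proj₂ ih)) ⟩
      18 * w + 2 * (p * e + bound k * w) + (2 * p * x + bound (suc k) * w) * (3 + n * 2)
        -- The inner terms of `a` lack the factor 2^(k+1); supplying it gives the same error as in
        -- `upper`.
        ≤⟨ ℕ.+-monoˡ-≤ _ (ℕ.+-monoˡ-≤ _ (ℕ.*-monoˡ-≤ w (ℕ.*-monoʳ-≤ 18 (1≤2^ (suc k))))) ⟩
      18 * (2 * p) * w + 2 * (p * e + bound k * w) + (2 * p * x + bound (suc k) * w) * (3 + n * 2)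
        ≤⟨ ℕ.m≤n+m _ (2 * p * t′) ⟩
      2 * p * t′ + (18 * (2 * p) * w + 2 * (p * e + bound k * w) + (2 * p * x + bound (suc k) * w) * (3 + n * 2))
        ≡⟨ collect p t′ w e x (bound k) n ⟩
      2 * p * (e + t′ + x * (3 + n * 2)) + bound (suc k) * (w * (4 + n * 2))
        ≡⟨ cong (λ z → 2 * p * z + bound (suc k) * (w * (4 + n * 2))) (sym (A-step n k)) ⟩
      2 * p * A (2 + n) (suc k) + bound (suc k) * even!! (2 + n) ∎
      where
      split : ∀ t y n → t + y * (5 + n * 2) ≡ t + 2 * y + y * (3 + n * 2)
      split = solve-∀
      collect : ∀ p t w e x b n →
        2 * p * t + (18 * (2 * p) * w + 2 * (p * e + b * w) + (2 * p * x + (2 * b + 18 * (2 * p)) * w) * (3 + n * 2)) ≡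
        2 * p * (e + t + x * (3 + n * 2)) + (2 * b + 18 * (2 * p)) * (w * (4 + n * 2))
      collect = solve-∀

  A-near : ∀ k → (∀ n → Near (bound k) n (2 ^ k * ends n k)) → ∀ n → Near (bound (suc k)) n (2 ^ suc k * A n (suc k))
  A-near k ends-near zero          = small 0 k (ℕ.≤-trans (ℕ.≤-reflexive a-zero) (ℕ.n≤1+n 1))
  A-near k ends-near (suc zero)    = small 1 k (ℕ.≤-reflexive a-one)
  A-near k ends-near (suc (suc n)) = near-step k n (ends-near (suc n)) (A-near k ends-near (suc n))

  -- For k = 0 the product A 0 0 · a n is already a n, so the error is A n 0 = (2n-1)!!. For larger
  -- k that product vanishes and the claim is `A-near` one level down.
  ends-near : ∀ k n → Near (bound k) n (2 ^ k * ends n k)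
  ends-near zero n = subst (Near 1 n) (sym (trans (ℕ.*-identityˡ (ends n 0)) (ends-zero n)))
    (ℕ.+-monoʳ-≤ (a n) (A-zero-bound n) , ℕ.≤-trans (ℕ.m≤m+n (a n) (A n 0)) (ℕ.m≤m+n _ _))
  ends-near (suc k) n = subst (λ x → Near (bound (suc k)) n (2 ^ suc k * x)) (sym (ends-suc n k)) (A-near k (ends-near k) n)

  -- Comparing squares avoids roots; the threshold is the factor in C² · (2 · a n)² = 4C² · (a n)².
  even!!-negligible : ∀ C n → 4 * (C * C) ≤ n → C * even!! n < a n
  even!!-negligible C n N≤n = ℕ.≰⇒> λ a≤CW → ℕ.<⇒≱ (ℕ.n<1+n n)
    (ℕ.*-cancelˡ-≤ (a n * a n) {{ℕ.>-nonZero a²>0}} (begin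
      a n * a n * (1 + n)                            ≤⟨ ℕ.*-monoˡ-≤ (1 + n) (ℕ.*-mono-≤ a≤CW a≤CW) ⟩
      C * even!! n * (C * even!! n) * (1 + n)        ≡⟨ regroup C (even!! n) n ⟩
      C * C * (even!! n * even!! n * (1 + n))        ≤⟨ ℕ.*-monoʳ-≤ (C * C) (even!!²≤odd!!² n) ⟩
      C * C * (odd!! (suc n) * odd!! (suc n))        ≤⟨ ℕ.*-monoʳ-≤ (C * C) (ℕ.*-mono-≤ (odd!!≤2a n) (odd!!≤2a n)) ⟩
      C * C * (2 * a n * (2 * a n))                  ≡⟨ regroup′ C (a n) ⟩
      a n * a n * (4 * (C * C))                      ≤⟨ ℕ.*-monoʳ-≤ (a n * a n) N≤n ⟩
      a n * a n * n                                  ∎))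
    where
    open ℕ.≤-Reasoning
    regroup : ∀ c w n → c * w * (c * w) * (1 + n) ≡ c * c * (w * w * (1 + n))
    regroup = solve-∀
    regroup′ : ∀ c x → c * c * (2 * x * (2 * x)) ≡ x * x * (4 * (c * c))
    regroup′ = solve-∀
    a>0 : 0 < a n
    a>0 = ℕ.*-cancelˡ-< 2 0 (a n) (ℕ.<-≤-trans (odd!!>0 (suc n)) (odd!!≤2a n))
      where
      odd!!>0 : ∀ n → 0 < odd!! n
      odd!!>0 zero    = s≤s z≤n
      odd!!>0 (suc n) = ℕ.*-mono-≤ (odd!!>0 n) (s≤s (z≤n {n * 2}))
    a²>0 : 0 < a n * a n
    a²>0 = ℕ.*-mono-≤ a>0 a>0

-- Convergence in distribution

<-+ᵘ : ∀ a b c d f q .{{_ : NonZero b}} .{{_ : NonZero d}} .{{_ : NonZero q}} →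
       a * (d * q) < (c * q + f * d) * b → (ℤ.+ a) ℚᵘ./ b ℚᵘ.< (ℤ.+ c) ℚᵘ./ d ℚᵘ.+ (ℤ.+ f) ℚᵘ./ q
<-+ᵘ a (suc b) c (suc d) f (suc q) p = *<* (subst₂ ℤ._<_ (ℤ.pos-* a (suc d * suc q))
  (trans (ℤ.pos-* (c * suc q + f * suc d) (suc b)) (cong (ℤ._* (ℤ.+ suc b))
    (trans (ℤ.pos-+ (c * suc q) (f * suc d)) (cong₂ ℤ._+_ (ℤ.pos-* c (suc q)) (ℤ.pos-* f (suc d))))))
  (ℤ.+<+ p))

toℚᵘ-/ : ∀ n d .{{_ : NonZero d}} → toℚᵘ (n ℚ./ d) ℚᵘ.≃ n ℚᵘ./ d
toℚᵘ-/ n (suc d) = ℚ.toℚᵘ-fromℚᵘ (mkℚᵘ n d)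

∣p-q∣<r : ∀ p q r → p ℚ.< q ℚ.+ r → q ℚ.< p ℚ.+ r → ℚ.∣ p ℚ.- q ∣ ℚ.< r
∣p-q∣<r p q r p<q+r q<p+r = by-sign (ℚ.∣p∣≡p∨∣p∣≡-p (p ℚ.- q))
  where
  open ℚ-Solver.+-*-Solver
  cancel : ∀ q r → q ℚ.+ r ℚ.- q ≡ r
  cancel = solve 2 (λ q r → q :+ r :- q := r) refl
  swap : ∀ p q → q ℚ.- p ≡ ℚ.- (p ℚ.- q)
  swap = solve 2 (λ p q → q :- p := :- (p :- q)) refl
  by-sign : ℚ.∣ p ℚ.- q ∣ ≡ p ℚ.- q ⊎ ℚ.∣ p ℚ.- q ∣ ≡ ℚ.- (p ℚ.- q) → ℚ.∣ p ℚ.- q ∣ ℚ.< r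
  by-sign (inj₁ e) = subst₂ ℚ._<_ (sym e) (cancel q r) (ℚ.+-monoˡ-< (ℚ.- q) p<q+r)
  by-sign (inj₂ e) = subst₂ ℚ._<_ (trans (swap p q) (sym e)) (cancel p r) (ℚ.+-monoˡ-< (ℚ.- p) q<p+r)

-- The hypotheses give |a/s - e/d| ≤ R/(d·s) ≤ R/s, and a positive η with denominator q is at least
-- 1/q; so q · R < s is enough.
fraction-near : ∀ a s e d R .{{_ : NonZero s}} .{{_ : NonZero d}} l → toℚᵘ l ℚᵘ.≃ (ℤ.+ e) ℚᵘ./ d →
  d * a ≤ e * s + R → e * s ≤ d * a + R →
  ∀ η → 0ℚ ℚ.< η → ℚ.↧ₙ η * R < s → ℚ.∣ (ℤ.+ a) ℚ./ s ℚ.- l ∣ ℚ.< η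
fraction-near _ _ _ _ _ _ _ _ _ (mkℚ (ℤ.+ zero) _ _) (ℚ.*<* (ℤ.+<+ ()))
fraction-near _ _ _ _ _ _ _ _ _ (mkℚ -[1+ _ ] _ _) (ℚ.*<* ())
fraction-near a s e d R l l≃ upper lower η@(mkℚ (ℤ.+ suc p) q-1 _) _ small = ∣p-q∣<r ((ℤ.+ a) ℚ./ s) l η
  (ℚ.toℚᵘ-cancel-< (ℚᵘ.<-respˡ-≃ (ℚᵘ.≃-sym (toℚᵘ-/ (ℤ.+ a) s)) (ℚᵘ.<-respʳ-≃
    (ℚᵘ.≃-sym (ℚᵘ.≃-trans (ℚ.toℚᵘ-homo-+ l η) (ℚᵘ.+-congˡ ηᵘ l≃))) (<-+ᵘ a s e d (suc p) q above))))
  (ℚ.toℚᵘ-cancel-< (ℚᵘ.<-respˡ-≃ (ℚᵘ.≃-sym l≃) (ℚᵘ.<-respʳ-≃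
    (ℚᵘ.≃-sym (ℚᵘ.≃-trans (ℚ.toℚᵘ-homo-+ ((ℤ.+ a) ℚ./ s) η) (ℚᵘ.+-congˡ ηᵘ (toℚᵘ-/ (ℤ.+ a) s)))) (<-+ᵘ e d a s (suc p) q below))))
  where
  open ℕ.≤-Reasoning
  ηᵘ = toℚᵘ η
  q = suc q-1
  above : a * (d * q) < (e * q + suc p * d) * s
  above = begin-strict
    a * (d * q)                  ≡⟨ regroup a d q ⟩
    q * (d * a)                  ≤⟨ ℕ.*-monoʳ-≤ q upper ⟩
    q * (e * s + R)              ≡⟨ ℕ.*-distribˡ-+ q (e * s) R ⟩
    q * (e * s) + q * R          <⟨ ℕ.+-monoʳ-< (q * (e * s)) small ⟩
    q * (e * s) + s              ≤⟨ ℕ.+-monoʳ-≤ (q * (e * s)) (ℕ.m≤n*m s (suc p * d) {{ℕ.m*n≢0 (suc p) d}}) ⟩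
    q * (e * s) + suc p * d * s  ≡⟨ collect q e s (suc p * d) ⟩
    (e * q + suc p * d) * s      ∎
    where
    regroup : ∀ a d q → a * (d * q) ≡ q * (d * a)
    regroup = solve-∀
    collect : ∀ q e s x → q * (e * s) + x * s ≡ (e * q + x) * s
    collect = solve-∀
  below : e * (s * q) < (a * q + suc p * s) * d
  below = begin-strict
    e * (s * q)                    ≡⟨ regroup e s q ⟩
    q * (e * s)                    ≤⟨ ℕ.*-monoʳ-≤ q lower ⟩
    q * (d * a + R)                ≡⟨ ℕ.*-distribˡ-+ q (d * a) R ⟩
    q * (d * a) + q * R            <⟨ ℕ.+-monoʳ-< (q * (d * a)) small ⟩
    q * (d * a) + s                ≤⟨ ℕ.+-monoʳ-≤ (q * (d * a)) (ℕ.m≤n*m s (suc p * d) {{ℕ.m*n≢0 (suc p) d}}) ⟩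
    q * (d * a) + suc p * d * s    ≡⟨ collect q d a (suc p) s ⟩
    (a * q + suc p * s) * d        ∎
    where
    regroup : ∀ e s q → e * (s * q) ≡ q * (e * s)
    regroup = solve-∀
    collect : ∀ q d a x s → q * (d * a) + x * d * s ≡ (a * q + x * s) * d
    collect = solve-∀

½^-≃ : ∀ k → toℚᵘ (½^ k) ℚᵘ.≃ ((ℤ.+ 1) ℚᵘ./ (2 ^ k)) {{ℕ.m^n≢0 2 k}}
½^-≃ zero    = ℚᵘ.≃-refl
½^-≃ (suc k) = ℚᵘ.≃-trans (ℚ.toℚᵘ-homo-* ½ (½^ k))
  (ℚᵘ.≃-trans (ℚᵘ.*-congˡ {toℚᵘ ½} (½^-≃ k)) (halve (2 ^ k) {{ℕ.m^n≢0 2 k}} {{ℕ.m^n≢0 2 (suc k)}}))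
  where
  halve : ∀ d .{{_ : NonZero d}} .{{_ : NonZero (2 * d)}} → toℚᵘ ½ ℚᵘ.* ((ℤ.+ 1) ℚᵘ./ d) ℚᵘ.≃ (ℤ.+ 1) ℚᵘ./ (2 * d)
  halve (suc d) = ℚᵘ.≃-refl

Converges-const : ∀ l → Converges (λ _ → l) l
Converges-const l η η>0 = 0 , λ _ _ → subst (ℚ._< η) (sym (cong ℚ.∣_∣ (ℚ.+-inverseʳ l))) η>0

Converges-+ : ∀ {s t l m} → Converges s l → Converges t m → Converges (λ n → s n ℚ.+ t n) (l ℚ.+ m)
Converges-+ {s} {t} {l} {m} p q η η>0 with p (½ ℚ.* η) half>0 | q (½ ℚ.* η) half>0
  where
  half>0 : 0ℚ ℚ.< ½ ℚ.* η
  half>0 = subst (ℚ._< ½ ℚ.* η) (ℚ.*-zeroʳ ½) (ℚ.*-monoʳ-<-pos ½ η>0)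
... | N , near | N′ , near′ = N ℕ.⊔ N′ , λ n n≥ → subst₂ ℚ._<_ refl (halves η)
  (ℚ.≤-<-trans (subst (λ x → ℚ.∣ x ∣ ℚ.≤ ℚ.∣ s n ℚ.- l ∣ ℚ.+ ℚ.∣ t n ℚ.- m ∣) (regroup (s n) (t n) l m)
                   (ℚ.∣p+q∣≤∣p∣+∣q∣ (s n ℚ.- l) (t n ℚ.- m)))
    (ℚ.+-mono-< (near n (ℕ.≤-trans (ℕ.m≤m⊔n N N′) n≥)) (near′ n (ℕ.≤-trans (ℕ.m≤n⊔m N N′) n≥))))
  where
  open ℚ-Solver.+-*-Solver
  regroup : ∀ s t l m → (s ℚ.- l) ℚ.+ (t ℚ.- m) ≡ (s ℚ.+ t) ℚ.- (l ℚ.+ m)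
  regroup = solve 4 (λ s t l m → (s :- l) :+ (t :- m) := (s :+ t) :- (l :+ m)) refl
  halves : ∀ η → ½ ℚ.* η ℚ.+ ½ ℚ.* η ≡ η
  halves η = trans (sym (ℚ.*-distribʳ-+ η ½ ½)) (ℚ.*-identityˡ η)

-- At a fixed x every distribution function involved sums the same finite set of masses.
masses⇒⟶ᵈ : ∀ {p q} → (∀ k → Converges (λ n → p n k) (q k)) → p ⟶ᵈ q
masses⇒⟶ᵈ {p} {q} masses x _ = sums (floor x)
  where
  sums : ∀ z → Converges (λ n → sumUpTo (p n) z) (sumUpTo q z)
  sums -[1+ _ ]    = Converges-const 0ℚ
  sums (ℤ.+ zero)    = masses 0
  sums (ℤ.+ (suc k)) = Converges-+ {λ n → sumUpTo (p n) (ℤ.+ k)} {λ n → p n (suc k)} (sums (ℤ.+ k)) (masses (suc k))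

module _ (Ω : ∀ n → UniformRootedMap n) where
  open Recurrences Ω
  open Asymptotics total count total-zero total-suc count≤total count-zero-zero count-zero-suc count-suc-zero count-suc-suc

  law-near : ∀ k e d C .{{_ : NonZero d}} l → toℚᵘ l ℚᵘ.≃ (ℤ.+ e) ℚᵘ./ d →
             (∀ n → d * count n k ≤ e * total n + C * even!! n × e * total n ≤ d * count n k + C * even!! n) →
             Converges (λ n → law-of-c (Ω n) k) l
  -- `fraction-near` asks for q · (C · (2n)!!) < a n, which is `even!!-negligible` for the constant
  -- q · C.
  law-near k e d C l l≃ near η η>0 = 4 * (q * C * (q * C)) , λ n n≥ →
    fraction-near (count n k) (total n) e d (C * even!! n) {{size-nonZero (Ω n)}} l l≃ (proj₁ (near n)) (proj₂ (near n)) η η>0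
      (subst (_< total n) (ℕ.*-assoc q C (even!! n)) (even!!-negligible (q * C) n n≥))
    where q = ℚ.↧ₙ η

  law-of-c-converges : ∀ k → Converges (λ n → law-of-c (Ω n) k) (geometric½ k)
  law-of-c-converges zero    = law-near 0 0 1 1 0ℚ ℚᵘ.≃-refl λ n →
    subst (_≤ 1 * even!! n) (sym (ℕ.*-identityˡ (count n 0))) (A-zero-bound n) , z≤n
  law-of-c-converges (suc k) = law-near (suc k) 1 (2 ^ suc k) (bound (suc k)) {{ℕ.m^n≢0 2 (suc k)}} (½^ suc k) (½^-≃ (suc k)) λ n →
    subst (λ x → 2 ^ suc k * count n (suc k) ≤ x + bound (suc k) * even!! n × x ≤ 2 ^ suc k * count n (suc k) + bound (suc k) * even!! n)
      (sym (ℕ.*-identityˡ (total n))) (A-near k (ends-near k) n)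

theorem5 : (∀ n → UniformRootedMap n) ×
    (∀ (Ω : ∀ n → UniformRootedMap n) → (λ n → law-of-c (Ω n)) ⟶ᵈ geometric½)
theorem5 = uniformRootedMap , λ Ω → masses⇒⟶ᵈ (law-of-c-converges Ω)
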